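{- Let ${\rm LZFC}^{sext}$ be the theory ${\rm BST}+Loc^{sext}({\rm ZFC})$. Then: (i) ${\rm LZFC}^{sext}\vdash {\rm Powerset}$. (ii) ${\rm LZFC}^{sext}\vdash \Sigma_1\text{ -Collection}$, i.e., for every $\Sigma_1$ formula $\phi(x,y,\overline{c})$ with parameters $\overline c$, ${\rm LZFC}^{sext}$ proves that for every set $a$, if $(\forall x\in a)(\exists y)\phi(x,y,\overline{c})$ then there is a set $b$ such that $(\forall x\in a)(\exists y\in b)\phi(x,y,\overline{c})$.
   Context: All theories are in the language $\{\in\}$. BST is the theory with axioms: Empty set, Extensionality, Pair, Union, Cartesian Product, "$\omega$ exists", and $\Delta_0$-Separation. "Model" means a (set) transitive model of ZFC, with membership as the $\in$-relation. A model $M$ is strongly extendible if for every set $x$ there is a model $N$ such that $x\in N$ and $M\prec N$ (elementary submodel). $Loc^{sext}({\rm ZFC})$ is the statement: every set $x$ belongs to some strongly extendible (transitive) model of ZFC. (${\rm LZFC}={\rm BST}+Loc({\rm ZFC})$, where $Loc({\rm ZFC})$ says that every set belongs to a transitive model of ZFC, so ${\rm LZFC}^{sext}={\rm LZFC}+Loc^{sext}({\rm ZFC})$.) A $\Sigma_1$ formula is one of the form $(\exists \overline{z})\psi$ with $\psi$ bounded ($\Delta_0$) and $\overline z$ a tuple of variables. -}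

module Defs where

open import Data.Nat using (ℕ; zero; suc; _+_; _∸_)
open import Data.Fin using (Fin; zero; suc; toℕ; lift; _↑ʳ_)
open import Data.List using (List; []; _∷_; map)
open import Data.List.Membership.Propositional using (_∈_)
open import Function using (id; _∘_)

-- Well-scoped de Bruijn syntax; variables are the only terms, so
-- substitution is renaming.
data Formula (n : ℕ) : Set where
  _ε_ _≐_ : Fin n → Fin n → Formula n
  ⊥'      : Formula n
  _⇒_     : Formula n → Formula n → Formula n
  ∀'      : Formula (suc n) → Formula n

Sentence : Set
Sentence = Formula 0

infix  9 _ε_ _≐_
infixr 7 _∧'_
infixr 6 _∨'_
infixr 5 _⇒_
infix  4 _⇔'_

¬' : ∀ {n} → Formula n → Formula n
¬' φ = φ ⇒ ⊥'

_∧'_ _∨'_ _⇔'_ : ∀ {n} → Formula n → Formula n → Formula n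
φ ∧' ψ = ¬' (φ ⇒ ¬' ψ)
φ ∨' ψ = ¬' φ ⇒ ψ
φ ⇔' ψ = (φ ⇒ ψ) ∧' (ψ ⇒ φ)

∃' : ∀ {n} → Formula (suc n) → Formula n
∃' φ = ¬' (∀' (¬' φ))

∀∈ ∃∈ : ∀ {n} → Fin n → Formula (suc n) → Formula n
∀∈ x φ = ∀' (zero ε suc x ⇒ φ)
∃∈ x φ = ∃' (zero ε suc x ∧' φ)

∀* : ∀ {n} → Formula n → Sentence
∀* {zero}  φ = φ
∀* {suc n} φ = ∀* (∀' φ)

ren : ∀ {m n} → (Fin m → Fin n) → Formula m → Formula n
ren ρ (x ε y) = ρ x ε ρ y
ren ρ (x ≐ y) = ρ x ≐ ρ y
ren ρ ⊥'      = ⊥'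
ren ρ (φ ⇒ ψ) = ren ρ φ ⇒ ren ρ ψ
ren ρ (∀' φ)  = ∀' (ren (lift 1 ρ) φ)

inst : ∀ {n} → Fin n → Fin (suc n) → Fin n
inst x zero    = x
inst x (suc y) = y

Theory : Set₁
Theory = Sentence → Set

infix 2 _⨾_⊢_ _⊢_

-- Classical natural deduction with equality.  The index n counts the
-- free variables in scope; `nonempty` is needed because n may be 0.
data _⨾_⊢_ (T : Theory) {n : ℕ} (Γ : List (Formula n)) : Formula n → Set where
  axiom    : ∀ {σ} → T σ → T ⨾ Γ ⊢ ren (λ ()) σ
  hyp      : ∀ {φ} → φ ∈ Γ → T ⨾ Γ ⊢ φ
  ⇒-intro  : ∀ {φ ψ} → T ⨾ φ ∷ Γ ⊢ ψ → T ⨾ Γ ⊢ φ ⇒ ψ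
  ⇒-elim   : ∀ {φ ψ} → T ⨾ Γ ⊢ φ ⇒ ψ → T ⨾ Γ ⊢ φ → T ⨾ Γ ⊢ ψ
  raa      : ∀ {φ} → T ⨾ ¬' φ ∷ Γ ⊢ ⊥' → T ⨾ Γ ⊢ φ
  ∀-intro  : ∀ {φ} → T ⨾ map (ren suc) Γ ⊢ φ → T ⨾ Γ ⊢ ∀' φ
  ∀-elim   : ∀ {φ} → T ⨾ Γ ⊢ ∀' φ → (x : Fin n) → T ⨾ Γ ⊢ ren (inst x) φ
  ≐-refl   : ∀ {x} → T ⨾ Γ ⊢ x ≐ x
  ≐-subst  : ∀ {x y} (φ : Formula (suc n)) → T ⨾ Γ ⊢ x ≐ y →
             T ⨾ Γ ⊢ ren (inst x) φ → T ⨾ Γ ⊢ ren (inst y) φ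
  nonempty : T ⨾ Γ ⊢ ∃' (zero ≐ zero)

_⊢_ : Theory → Sentence → Set
T ⊢ σ = T ⨾ [] ⊢ σ

-- `∃∈ˡ` is listed separately because ∃∈ y φ is not literally built from
-- ⇒, ⊥' and bounded ∀; closure under ¬', ∧', ∨', ⇔' is automatic.
data Δ₀ {n : ℕ} : Formula n → Set where
  εˡ  : ∀ {x y} → Δ₀ (x ε y)
  ≐ˡ  : ∀ {x y} → Δ₀ (x ≐ y)
  ⊥ˡ  : Δ₀ ⊥'
  ⇒ˡ  : ∀ {φ ψ} → Δ₀ φ → Δ₀ ψ → Δ₀ (φ ⇒ ψ)
  ∀∈ˡ : ∀ {y φ} → Δ₀ φ → Δ₀ (∀∈ y φ)
  ∃∈ˡ : ∀ {y φ} → Δ₀ φ → Δ₀ (∃∈ y φ)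

data Σ₁ {n : ℕ} : Formula n → Set where
  bounded : ∀ {φ} → Δ₀ φ → Σ₁ φ
  exists  : ∀ {φ} → Σ₁ φ → Σ₁ (∃' φ)

pattern v0 = zero
pattern v1 = suc v0
pattern v2 = suc v1
pattern v3 = suc v2

_⊆'_ : ∀ {n} → Fin n → Fin n → Formula n
x ⊆' y = ∀∈ x (v0 ε suc y)

IsEmpty : ∀ {n} → Fin n → Formula n
IsEmpty x = ∀' (¬' (v0 ε suc x))

-- y = x ∪ {x}
IsSuc : ∀ {n} → Fin n → Fin n → Formula n
IsSuc y x = ∀' (v0 ε suc y ⇔' (v0 ε suc x ∨' v0 ≐ suc x))

-- z = {x , y}
IsUPair : ∀ {n} → Fin n → Fin n → Fin n → Formula n
IsUPair z x y = ∀' (v0 ε suc z ⇔' (v0 ≐ suc x ∨' v0 ≐ suc y))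

-- z = {{x} , {x , y}}
IsPair : ∀ {n} → Fin n → Fin n → Fin n → Formula n
IsPair z x y =
  ∃' (IsUPair v0 (1 ↑ʳ x) (1 ↑ʳ x) ∧'
    ∃' (IsUPair v0 (2 ↑ʳ x) (2 ↑ʳ y) ∧' IsUPair (2 ↑ʳ z) v1 v0))

Inductive : ∀ {n} → Fin n → Formula n
Inductive w = ∃∈ w (IsEmpty v0) ∧' ∀∈ w (∃∈ (suc w) (IsSuc v0 v1))

-- ω as the least inductive set: without Foundation this is the robust
-- definition.
Isω : ∀ {n} → Fin n → Formula n
Isω w = Inductive w ∧' ∀' (Inductive v0 ⇒ suc w ⊆' v0)

Natural : ∀ {n} → Fin n → Formula n
Natural x = ∃' (Isω v0 ∧' suc x ε v0)

Extensionality EmptySet Pair Union CartesianProduct ω-exists : Sentence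
Infinity Foundation Powerset Choice : Sentence

Extensionality = ∀' (∀' (∀' (v0 ε v2 ⇔' v0 ε v1) ⇒ v1 ≐ v0))

EmptySet = ∃' (IsEmpty v0)

Pair = ∀' (∀' (∃' (IsUPair v0 v2 v1)))

Union = ∀' (∃' (∀' (v0 ε v1 ⇔' ∃∈ v2 (v1 ε v0))))

CartesianProduct =
  ∀' (∀' (∃' (∀' (v0 ε v1 ⇔' ∃∈ v3 (∃∈ v3 (IsPair v2 v1 v0))))))

ω-exists = ∃' (Isω v0)

Infinity = ∃' (Inductive v0)

Foundation = ∀' (∃' (v0 ε v1) ⇒ ∃∈ v0 (∀∈ v0 (¬' (v0 ε v2))))

Powerset = ∀' (∃' (∀' (v0 ε v1 ⇔' v0 ⊆' v2)))

-- Every set of nonempty, pairwise disjoint sets has a transversal.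
Choice =
  ∀' (∀∈ v0 (∃' (v0 ε v1)) ∧'
      ∀∈ v0 (∀∈ v1 (∃' (v0 ε v2 ∧' v0 ε v1) ⇒ v1 ≐ v0))
    ⇒ ∃' (∀∈ v1 (∃' (∀' ((v0 ε v2 ∧' v0 ε v3) ⇔' v0 ≐ v1)))))

-- φ has free variables x , p₁ , … , pₙ with x = v0;  in scope under the
-- quantifiers are x , b , a , p₁ , … , pₙ.
Separation : ∀ {n} → Formula (1 + n) → Sentence
Separation φ =
  ∀* (∀' (∃' (∀' (v0 ε v1 ⇔' (v0 ε v2 ∧' ren (lift 1 (2 ↑ʳ_)) φ)))))

-- φ has free variables y , x , c₁ , … , cₙ with y = v0 and x = v1.
Collection : ∀ {n} → Formula (2 + n) → Sentence
Collection φ =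
  ∀* (∀' (∀∈ v0 (∃' (ren (lift 2 (1 ↑ʳ_)) φ)) ⇒
          ∃' (∀∈ v1 (∃∈ v1 (ren (lift 2 (2 ↑ʳ_)) φ)))))

data BST : Theory where
  empty    : BST EmptySet
  ext      : BST Extensionality
  pair     : BST Pair
  union    : BST Union
  cartProd : BST CartesianProduct
  omega    : BST ω-exists
  Δ₀-sep   : ∀ {n} {φ : Formula (1 + n)} → Δ₀ φ → BST (Separation φ)

data Tm (n : ℕ) : Set where
  `_    : Fin n → Tm n
  ∅     : Tm n
  sucᵗ  : Tm n → Tm n
  ⟨_,_⟩ : Tm n → Tm n → Tm n

infix 10 `_

-- The formula "x = t[ρ]".
isᵉ : ∀ {m n} → (Fin m → Fin n) → Fin n → Tm m → Formula n
isᵉ ρ x (` y)     = x ≐ ρ y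
isᵉ ρ x ∅         = IsEmpty x
isᵉ ρ x (sucᵗ t)  = ∃' (isᵉ (suc ∘ ρ) v0 t ∧' IsSuc (suc x) v0)
isᵉ ρ x ⟨ t , u ⟩ =
  ∃' (isᵉ (suc ∘ ρ) v0 t ∧'
    ∃' (isᵉ ((2 ↑ʳ_) ∘ ρ) v0 u ∧' IsPair (2 ↑ʳ x) v1 v0))

infix 9 _is_ _∈ᵗ_

_is_ : ∀ {n} → Fin n → Tm n → Formula n
x is t = isᵉ id x t

_∈ᵗ_ : ∀ {n} → Tm n → Fin n → Formula n
t ∈ᵗ x = ∃∈ x (isᵉ suc v0 t)

num : ∀ {n} → ℕ → Tm n
num zero    = ∅
num (suc k) = sucᵗ (num k)

-- s is a function from k to M
Map : ∀ {n} → Fin n → Fin n → Fin n → Formula n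
Map s k M =
  ∀∈ s (∃∈ (1 ↑ʳ k) (∃∈ (2 ↑ʳ M) (v2 is ⟨ ` v1 , ` v0 ⟩))) ∧'
  ∀∈ k (∃' (∀' (⟨ ` v2 , ` v0 ⟩ ∈ᵗ (3 ↑ʳ s) ⇔' v0 ≐ v1)))

-- vᵢ ∈ vⱼ,  vᵢ = vⱼ,  ⊥,  f ⇒ g,  ∀ vᵢ f
memᶜ eqᶜ impᶜ allᶜ : ∀ {n} → Tm n → Tm n → Tm n
⊥ᶜ : ∀ {n} → Tm n
memᶜ i j = ⟨ num 0 , ⟨ i , j ⟩ ⟩
eqᶜ  i j = ⟨ num 1 , ⟨ i , j ⟩ ⟩
⊥ᶜ       = ⟨ num 2 , ∅ ⟩
impᶜ f g = ⟨ num 3 , ⟨ f , g ⟩ ⟩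
allᶜ i f = ⟨ num 4 , ⟨ i , f ⟩ ⟩

notᶜ : ∀ {n} → Tm n → Tm n
notᶜ f = impᶜ f ⊥ᶜ

andᶜ iffᶜ exᶜ : ∀ {n} → Tm n → Tm n → Tm n
andᶜ f g = notᶜ (impᶜ f (notᶜ g))
iffᶜ f g = andᶜ (impᶜ f g) (impᶜ g f)
exᶜ  i f = notᶜ (allᶜ i (notᶜ f))

-- De Bruijn levels serve as names: the outermost variable in scope is
-- v₀, and a quantifier in a scope of n variables binds vₙ.
⌜_⌝ : ∀ {n m} → Formula n → Tm m
⌜_⌝ {n} (x ε y) = memᶜ (num (n ∸ suc (toℕ x))) (num (n ∸ suc (toℕ y)))
⌜_⌝ {n} (x ≐ y) = eqᶜ (num (n ∸ suc (toℕ x))) (num (n ∸ suc (toℕ y)))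
⌜ ⊥' ⌝          = ⊥ᶜ
⌜ φ ⇒ ψ ⌝       = impᶜ ⌜ φ ⌝ ⌜ ψ ⌝
⌜_⌝ {n} (∀' φ)  = allᶜ (num n) ⌜ φ ⌝

-- h is an atom in variables from {vᵢ : i ∈ k}, or is obtained by one
-- formation rule from values of g at arguments in m.
FormStep : ∀ {n} → (k g m h : Fin n) → Formula n
FormStep k g m h =
     ∃∈ k (∃∈ (1 ↑ʳ k) ((2 ↑ʳ h) is memᶜ (` v1) (` v0)))
  ∨' ∃∈ k (∃∈ (1 ↑ʳ k) ((2 ↑ʳ h) is eqᶜ (` v1) (` v0)))
  ∨' h is ⊥ᶜ
  ∨' ∃∈ m (∃∈ (1 ↑ʳ m) (∃' (∃' (          -- p , q ∈ m; a = g(p), b = g(q)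
       ⟨ ` v3 , ` v1 ⟩ ∈ᵗ (4 ↑ʳ g) ∧'
       ⟨ ` v2 , ` v0 ⟩ ∈ᵗ (4 ↑ʳ g) ∧'
       (4 ↑ʳ h) is impᶜ (` v1) (` v0)))))
  ∨' ∃∈ k (∃∈ (1 ↑ʳ m) (∃' (              -- i ∈ k, p ∈ m; a = g(p)
       ⟨ ` v1 , ` v0 ⟩ ∈ᵗ (3 ↑ʳ g) ∧'
       (3 ↑ʳ h) is allᶜ (` v2) (` v0))))

-- k ∈ ω, and f is a formula all of whose variables, free or bound, are
-- among {vᵢ : i ∈ k}:  some g with domain ℓ = n + 1 and codomain D is a
-- formation sequence ending in g(n) = f.
Form : ∀ {n} → (k f : Fin n) → Formula n
Form k f =
  Natural k ∧'
  ∃' (∃' (∃' (∃' (                        -- n , ℓ , D , g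
    Natural v3 ∧' v2 is sucᵗ (` v3) ∧' Map v0 v2 v1 ∧'
    ⟨ ` v3 , ` (4 ↑ʳ f) ⟩ ∈ᵗ v0 ∧'
    ∀∈ v2 (∀' (                           -- m , h
      ⟨ ` v1 , ` v0 ⟩ ∈ᵗ v2 ⇒ FormStep (6 ↑ʳ k) v2 v1 v0))))))

-- s(j) = s′(j) for all j ∈ k other than i
AgreeOff : ∀ {n} → (i k s s′ : Fin n) → Formula n
AgreeOff i k s s′ =
  ∀∈ k (¬' (v0 ≐ suc i) ⇒
    ∀' (⟨ ` v1 , ` v0 ⟩ ∈ᵗ (2 ↑ʳ s) ⇔' ⟨ ` v1 , ` v0 ⟩ ∈ᵗ (2 ↑ʳ s′)))

-- Tarski's clauses for S at assignments s : k → M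
TarskiClauses : ∀ {n} → (M S k s : Fin n) → Formula n
TarskiClauses M S k s =
     ∀∈ k (∀∈ (1 ↑ʳ k) (                  -- i , j
       ⟨ memᶜ (` v1) (` v0) , ` (2 ↑ʳ s) ⟩ ∈ᵗ (2 ↑ʳ S) ⇔'
       ∃' (∃' (⟨ ` v3 , ` v1 ⟩ ∈ᵗ (4 ↑ʳ s) ∧'
               ⟨ ` v2 , ` v0 ⟩ ∈ᵗ (4 ↑ʳ s) ∧' v1 ε v0))))
  ∧' ∀∈ k (∀∈ (1 ↑ʳ k) (                  -- i , j
       ⟨ eqᶜ (` v1) (` v0) , ` (2 ↑ʳ s) ⟩ ∈ᵗ (2 ↑ʳ S) ⇔'
       ∃' (∃' (⟨ ` v3 , ` v1 ⟩ ∈ᵗ (4 ↑ʳ s) ∧'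
               ⟨ ` v2 , ` v0 ⟩ ∈ᵗ (4 ↑ʳ s) ∧' v1 ≐ v0))))
  ∧' ¬' (⟨ ⊥ᶜ , ` s ⟩ ∈ᵗ S)
  ∧' ∀' (∀' (Form (2 ↑ʳ k) v1 ∧' Form (2 ↑ʳ k) v0 ⇒   -- f , g
       (⟨ impᶜ (` v1) (` v0) , ` (2 ↑ʳ s) ⟩ ∈ᵗ (2 ↑ʳ S) ⇔'
        (⟨ ` v1 , ` (2 ↑ʳ s) ⟩ ∈ᵗ (2 ↑ʳ S) ⇒
         ⟨ ` v0 , ` (2 ↑ʳ s) ⟩ ∈ᵗ (2 ↑ʳ S)))))
  ∧' ∀∈ k (∀' (Form (2 ↑ʳ k) v0 ⇒         -- i , f
       (⟨ allᶜ (` v1) (` v0) , ` (2 ↑ʳ s) ⟩ ∈ᵗ (2 ↑ʳ S) ⇔'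
        ∀' (Map v0 (3 ↑ʳ k) (3 ↑ʳ M) ∧' AgreeOff v2 (3 ↑ʳ k) (3 ↑ʳ s) v0 ⇒
          ⟨ ` v1 , ` v0 ⟩ ∈ᵗ (3 ↑ʳ S)))))

IsSat : ∀ {n} → (M S : Fin n) → Formula n
IsSat M S =
  ∀' (∀' (Natural v1 ∧' Map v0 v1 (2 ↑ʳ M) ⇒    -- k , s
    TarskiClauses (2 ↑ʳ M) (2 ↑ʳ S) v1 v0))

-- M ⊨ f[s].  Weak set theories may fail to prove that a satisfaction
-- relation for M exists; its existence is part of the definition.
Sat : ∀ {n} → (M f s : Fin n) → Formula n
Sat M f s = ∃' (IsSat (suc M) v0 ∧' ⟨ ` (suc f) , ` (suc s) ⟩ ∈ᵗ v0)

-- M ⊨ f, i.e. M ⊨ f[s] for all assignments s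
Valid : ∀ {n} → (M f : Fin n) → Formula n
Valid M f =
  ∀' (∀' (Form v1 (2 ↑ʳ f) ∧' Map v0 v1 (2 ↑ʳ M) ⇒    -- k , s
    Sat (2 ↑ʳ M) (2 ↑ʳ f) v0))

-- Instances of the two schemas for a code g whose variables are among
-- {vᵢ : i ∈ k}, so that v_k , v_{k+1} , … are fresh.  The remaining
-- variables of g are parameters; Valid takes the universal closure.

-- ∀a ∃b ∀x (x ∈ b ⇔ x ∈ a ∧ g(x)) with x = v₀
sepᶜ : ∀ {n} → Tm n → Tm n → Tm n
sepᶜ k g = allᶜ a (exᶜ b (allᶜ x (iffᶜ (memᶜ x b) (andᶜ (memᶜ x a) g))))
  where
  x = num 0
  a = k
  b = sucᵗ k

-- ∀a (∀x∈a ∃!y g(x,y) ⇒ ∃b ∀x∈a ∃y∈b g(x,y)) with x = v₀, y = v₁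
replᶜ : ∀ {n} → Tm n → Tm n → Tm n
replᶜ k g =
  allᶜ a (impᶜ
    (allᶜ x (impᶜ (memᶜ x a) (exᶜ z (allᶜ y (iffᶜ g (eqᶜ y z))))))
    (exᶜ b (allᶜ x (impᶜ (memᶜ x a) (exᶜ y (andᶜ (memᶜ y b) g))))))
  where
  x = num 0
  y = num 1
  a = k
  z = sucᵗ k
  b = sucᵗ (sucᵗ k)

IsZFCAxiom : ∀ {n} → Fin n → Formula n
IsZFCAxiom f =
     f is ⌜ Extensionality ⌝
  ∨' f is ⌜ Foundation ⌝
  ∨' f is ⌜ Pair ⌝
  ∨' f is ⌜ Union ⌝
  ∨' f is ⌜ Powerset ⌝
  ∨' f is ⌜ Infinity ⌝
  ∨' f is ⌜ Choice ⌝
  ∨' ∃' (∃' (Form v1 v0 ∧' num 0 ∈ᵗ v1 ∧'       -- k , g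
       (2 ↑ʳ f) is sepᶜ (` v1) (` v0)))
  ∨' ∃' (∃' (Form v1 v0 ∧' num 1 ∈ᵗ v1 ∧'       -- k , g
       (2 ↑ʳ f) is replᶜ (` v1) (` v0)))

Transitive : ∀ {n} → Fin n → Formula n
Transitive M = ∀∈ M (v0 ⊆' suc M)

-- First-order structures are nonempty.
Model : ∀ {n} → Fin n → Formula n
Model M =
  ∃' (v0 ε suc M) ∧' Transitive M ∧' ∀' (IsZFCAxiom v0 ⇒ Valid (suc M) v0)

-- M ≺ N
Elementary : ∀ {n} → (M N : Fin n) → Formula n
Elementary M N =
  M ⊆' N ∧'
  ∀' (∀' (∀' (Form v2 v1 ∧' Map v0 v2 (3 ↑ʳ M) ⇒      -- k , f , s
    (Sat (3 ↑ʳ M) v1 v0 ⇔' Sat (3 ↑ʳ N) v1 v0))))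

StronglyExtendible : ∀ {n} → Fin n → Formula n
StronglyExtendible M =
  Model M ∧' ∀' (∃' (Model v0 ∧' v1 ε v0 ∧' Elementary (2 ↑ʳ M) v0))

Locˢᵉˣᵗ : Sentence
Locˢᵉˣᵗ = ∀' (∃' (v1 ε v0 ∧' StronglyExtendible v0))

data LZFCˢᵉˣᵗ : Theory where
  bst : ∀ {σ} → BST σ → LZFCˢᵉˣᵗ σ
  loc : LZFCˢᵉˣᵗ Locˢᵉˣᵗ

{-# OPTIONS --safe #-}

-- Derivability is reduced to truth in structures by a constructive
-- completeness theorem in the style of Krivine: structures interpret ⊥ by
-- an arbitrary set, ⇒ and ∀' by Agda's function types, and the Henkin
-- extension decides nothing, since a formula is admitted together with a
-- proof that admitting it preserves consistency relative to ¬σ.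
--
-- Inside a structure, let M be strongly extendible with x ∈ M.  If p ∈ M
-- is the power set of x in the sense of M and y ⊆ x is any set, then some
-- N ≻ M contains y and still believes that p is the power set of x, so
-- y ∈ p.  If M contains a and the parameters, x ∈ a, and φ(x,y) is Σ₁ and
-- true, then some N ≻ M contains y and the witnesses for φ, so
-- N ⊨ ∃y φ(x,y), hence M ⊨ ∃y φ(x,y), and Collection holds with b = M.
-- Both arguments need that satisfaction of ⌜ φ ⌝ in M, in the sense of
-- Tarski's clauses, is equivalent to the relativisation of φ to M.

module Submission where

open import Defs
open import Data.Nat
  using (ℕ; zero; suc; _+_; _∸_; _⊔_; _≤_; _<_; _≤′_; s≤s; ≤′-refl; ≤′-step; _≟_)
open import Data.Nat.Properties
open import Data.Fin using (Fin; zero; suc; toℕ; lift; fromℕ<; _↑ʳ_)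
open import Data.Fin.Properties using (toℕ<n; toℕ-fromℕ<)
open import Data.List using (List; []; _∷_; map; _++_; allFin; cartesianProductWith)
open import Data.List.Membership.Propositional using (_∈_)
open import Data.List.Membership.Propositional.Properties
  using (∈-cartesianProductWith⁺; ∈-map⁺; ∈-++⁺ˡ; ∈-++⁺ʳ; ∈-allFin)
open import Data.List.Relation.Unary.Any using (here; there)
open import Data.List.Relation.Unary.All as All using (All; []; _∷_)
open import Data.List.Relation.Unary.All.Properties using (++⁺)
import Data.List.Relation.Binary.Subset.Propositional as List
open import Data.List.Relation.Binary.Subset.Propositional.Properties
  using (map⁺; ∷⁺ʳ; xs⊆xs++ys; xs⊆ys++xs)
open import Data.Product using (Σ; _×_; _,_; proj₁; proj₂)
open import Data.Sum using (_⊎_; inj₁; inj₂)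
open import Data.Unit using (⊤; tt)
open import Data.Empty using (⊥-elim)
open import Function using (_∘_; id)
open import Relation.Nullary using (yes; no)
open import Relation.Binary.PropositionalEquality
  using (_≡_; refl; sym; trans; cong; cong₂; subst; subst₂)

private variable
  o m n : ℕ
  A B C : Set

-- Environments, renaming and weakening

infixl 5 _▸_
_▸_ : (Fin n → A) → A → Fin (suc n) → A
(ρ ▸ a) zero    = a
(ρ ▸ a) (suc i) = ρ i

∅ᵉ : Fin 0 → A
∅ᵉ ()

lift-cong : {f g : Fin m → Fin n} → (∀ i → f i ≡ g i) → ∀ i → lift 1 f i ≡ lift 1 g i
lift-cong eq zero    = refl
lift-cong eq (suc i) = cong suc (eq i)

ren-cong : {f g : Fin m → Fin n} → (∀ i → f i ≡ g i) → ∀ φ → ren f φ ≡ ren g φ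
ren-cong eq (x ε y) = cong₂ _ε_ (eq x) (eq y)
ren-cong eq (x ≐ y) = cong₂ _≐_ (eq x) (eq y)
ren-cong eq ⊥'      = refl
ren-cong eq (φ ⇒ ψ) = cong₂ _⇒_ (ren-cong eq φ) (ren-cong eq ψ)
ren-cong eq (∀' φ)  = cong ∀' (ren-cong (lift-cong eq) φ)

ren-∘ : (f : Fin m → Fin n) (g : Fin o → Fin m) → ∀ φ → ren f (ren g φ) ≡ ren (f ∘ g) φ
ren-∘ f g (x ε y) = refl
ren-∘ f g (x ≐ y) = refl
ren-∘ f g ⊥'      = refl
ren-∘ f g (φ ⇒ ψ) = cong₂ _⇒_ (ren-∘ f g φ) (ren-∘ f g ψ)
ren-∘ f g (∀' φ)  = cong ∀' (trans (ren-∘ (lift 1 f) (lift 1 g) φ)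
                                   (ren-cong (λ { zero → refl ; (suc i) → refl }) φ))

weaken : ∀ {T} {Γ Δ : List (Formula n)} {φ} → Γ List.⊆ Δ → T ⨾ Γ ⊢ φ → T ⨾ Δ ⊢ φ
weaken s (axiom t)       = axiom t
weaken s (hyp x)         = hyp (s x)
weaken s (⇒-intro d)     = ⇒-intro (weaken (∷⁺ʳ _ s) d)
weaken s (⇒-elim d e)    = ⇒-elim (weaken s d) (weaken s e)
weaken s (raa d)         = raa (weaken (∷⁺ʳ _ s) d)
weaken s (∀-intro d)     = ∀-intro (weaken (map⁺ (ren suc) s) d)
weaken s (∀-elim d x)    = ∀-elim (weaken s d) x
weaken s ≐-refl          = ≐-refl
weaken s (≐-subst φ d e) = ≐-subst φ (weaken s d) (weaken s e)
weaken s nonempty        = nonempty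

-- The truth value ⊥ is arbitrary: a structure may be inconsistent, in
-- which case everything holds in it.
record Structure : Set₁ where
  infix 9 _∈ₛ_ _≈_
  field
    Dom       : Set
    _∈ₛ_ _≈_  : Dom → Dom → Set
    ⊥         : Set
    ∈-stable  : ∀ {x y} → ((x ∈ₛ y → ⊥) → ⊥) → x ∈ₛ y
    ≈-stable  : ∀ {x y} → ((x ≈ y → ⊥) → ⊥) → x ≈ y
    ≈-refl    : ∀ {x} → x ≈ x
    ≈-substˡ  : ∀ {x y z} → x ≈ y → x ∈ₛ z → y ∈ₛ z
    ≈-substʳ  : ∀ {x y z} → x ≈ y → z ∈ₛ x → z ∈ₛ y
    ≈-euclid  : ∀ {x y z} → x ≈ y → x ≈ z → y ≈ z

  ⟦_⟧ : Formula n → (Fin n → Dom) → Set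
  ⟦ x ε y ⟧ ρ = ρ x ∈ₛ ρ y
  ⟦ x ≐ y ⟧ ρ = ρ x ≈ ρ y
  ⟦ ⊥' ⟧    ρ = ⊥
  ⟦ φ ⇒ ψ ⟧ ρ = ⟦ φ ⟧ ρ → ⟦ ψ ⟧ ρ
  ⟦ ∀' φ ⟧  ρ = ∀ d → ⟦ φ ⟧ (ρ ▸ d)

  infix 3 ⊨_
  ⊨_ : Sentence → Set
  ⊨ σ = ⟦ σ ⟧ ∅ᵉ

Entails : Theory → Sentence → Set₁
Entails T σ = (𝓜 : Structure) → let open Structure 𝓜 in (∀ {τ} → T τ → ⊨ τ) → ⊨ σ

-- Exhaustive finite lists of formulas

depth : Formula n → ℕ
depth (x ε y) = 1
depth (x ≐ y) = 1
depth ⊥'      = 1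
depth (φ ⇒ ψ) = suc (depth φ ⊔ depth ψ)
depth (∀' φ)  = suc (depth φ)

depth-ren : (f : Fin m → Fin n) → ∀ φ → depth (ren f φ) ≡ depth φ
depth-ren f (x ε y) = refl
depth-ren f (x ≐ y) = refl
depth-ren f ⊥'      = refl
depth-ren f (φ ⇒ ψ) = cong suc (cong₂ _⊔_ (depth-ren f φ) (depth-ren f ψ))
depth-ren f (∀' φ)  = cong suc (depth-ren (lift 1 f) φ)

-- Variables are the only terms, so only finitely many formulas fit a given depth and scope. The
-- Henkin construction treats one such list per stage.
formulas : ℕ → ∀ n → List (Formula n)
formulas zero    n = []
formulas (suc d) n =
  ⊥' ∷ (cartesianProductWith _ε_ (allFin n) (allFin n) ++
       (cartesianProductWith _≐_ (allFin n) (allFin n) ++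
       (cartesianProductWith _⇒_ (formulas d n) (formulas d n) ++
        map ∀' (formulas d (suc n)))))

∈-formulas : ∀ {d} (φ : Formula n) → depth φ ≤ d → φ ∈ formulas d n
∈-formulas (x ε y) (s≤s p) =
  there (∈-++⁺ˡ (∈-cartesianProductWith⁺ _ε_ (∈-allFin x) (∈-allFin y)))
∈-formulas {n} (x ≐ y) (s≤s p) =
  there (∈-++⁺ʳ (cartesianProductWith _ε_ (allFin n) (allFin n))
    (∈-++⁺ˡ (∈-cartesianProductWith⁺ _≐_ (∈-allFin x) (∈-allFin y))))
∈-formulas ⊥' (s≤s p) = here refl
∈-formulas {n} (φ ⇒ ψ) (s≤s p) =
  there (∈-++⁺ʳ (cartesianProductWith _ε_ (allFin n) (allFin n))
    (∈-++⁺ʳ (cartesianProductWith _≐_ (allFin n) (allFin n))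
      (∈-++⁺ˡ (∈-cartesianProductWith⁺ _⇒_
        (∈-formulas φ (m⊔n≤o⇒m≤o _ _ p)) (∈-formulas ψ (m⊔n≤o⇒n≤o (depth φ) _ p))))))
∈-formulas {n} {suc d} (∀' φ) (s≤s p) =
  there (∈-++⁺ʳ (cartesianProductWith _ε_ (allFin n) (allFin n))
    (∈-++⁺ʳ (cartesianProductWith _≐_ (allFin n) (allFin n))
      (∈-++⁺ʳ (cartesianProductWith _⇒_ (formulas d n) (formulas d n))
        (∈-map⁺ ∀' (∈-formulas φ p)))))

strictBound : (ρ : Fin o → ℕ) → Σ ℕ λ b → ∀ i → ρ i < b
strictBound {zero}  ρ = 0 , λ ()
strictBound {suc o} ρ with strictBound (ρ ∘ suc)
... | b , ρ< = suc (ρ zero) ⊔ b , λ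
  { zero → m≤m⊔n _ b ; (suc i) → ≤-trans (ρ< i) (m≤n⊔m (suc (ρ zero)) b) }

-- Completeness

module Completeness (T : Theory) where

  -- Natural numbers serve as Henkin constants: the free variables of a formula are given such
  -- names, so the language itself is never extended.
  record Closure : Set where
    constructor _[_]
    field
      {size}  : ℕ
      formula : Formula size
      env     : Fin size → ℕ
  open Closure

  infix 6 _·_
  _·_ : (ℕ → Fin m) → Closure → Formula m
  r · (φ [ ρ ]) = ren (r ∘ ρ) φ

  infix 2 _⊩_
  -- Entailment over the infinitely many names in ℕ is derivability
  -- uniformly in all interpretations r of the names.
  record _⊩_ (G : Closure → Set) (C : Closure) : Set where
    constructor ⊩-intro
    field
      premises : List Closure
      all      : All G premises
      derive   : ∀ {m} (r : ℕ → Fin m) → T ⨾ map (r ·_) premises ⊢ r · C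

  private variable
    G H : Closure → Set
    φ ψ : Formula n
    ρ : Fin n → ℕ

  ⊥ᵒ : Closure
  ⊥ᵒ = ⊥' [ ∅ᵉ ]

  ⊩-mono : (∀ {C} → G C → H C) → ∀ {C} → G ⊩ C → H ⊩ C
  ⊩-mono s (⊩-intro L all d) = ⊩-intro L (All.map s all) d

  ⊩-map : ∀ {C C′} → (∀ {m} (r : ℕ → Fin m) {Γ} → T ⨾ Γ ⊢ r · C → T ⨾ Γ ⊢ r · C′) →
          G ⊩ C → G ⊩ C′
  ⊩-map f (⊩-intro L all d) = ⊩-intro L all (λ r → f r (d r))

  ⊩-map₂ : ∀ {C₁ C₂ C} →
           (∀ {m} (r : ℕ → Fin m) {Γ} → T ⨾ Γ ⊢ r · C₁ → T ⨾ Γ ⊢ r · C₂ → T ⨾ Γ ⊢ r · C) →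
           G ⊩ C₁ → G ⊩ C₂ → G ⊩ C
  ⊩-map₂ f (⊩-intro L all d) (⊩-intro L′ all′ d′) = ⊩-intro (L ++ L′) (++⁺ all all′) λ r →
    f r (weaken (map⁺ (r ·_) (xs⊆xs++ys L L′)) (d r))
        (weaken (map⁺ (r ·_) (xs⊆ys++xs L′ L)) (d′ r))

  ⊩-hyp : ∀ {C} → G C → G ⊩ C
  ⊩-hyp g = ⊩-intro (_ ∷ []) (g ∷ []) (λ r → hyp (here refl))

  ⊩-transport : ∀ {C C′} → (∀ {m} (r : ℕ → Fin m) → r · C ≡ r · C′) → G ⊩ C → G ⊩ C′
  ⊩-transport eq = ⊩-map λ r → subst (λ χ → T ⨾ _ ⊢ χ) (eq r)

  contrapositive : {Γ : List (Formula n)} {φ ψ : Formula n} →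
                   T ⨾ φ ∷ Γ ⊢ ψ → T ⨾ Γ ⊢ ¬' ψ → T ⨾ Γ ⊢ ¬' φ
  contrapositive d e = ⇒-intro (⇒-elim (weaken there e) d)

  ex-falso : {Γ : List (Formula n)} {φ : Formula n} → T ⨾ Γ ⊢ ⊥' → T ⨾ Γ ⊢ φ
  ex-falso d = raa (weaken there d)

  ¬⇒-left : {Γ : List (Formula n)} {φ ψ : Formula n} → T ⨾ Γ ⊢ ¬' (φ ⇒ ψ) → T ⨾ Γ ⊢ φ
  ¬⇒-left d = raa (⇒-elim (weaken there d)
    (⇒-intro (ex-falso (⇒-elim (hyp (there (here refl))) (hyp (here refl))))))

  ¬⇒-right : {Γ : List (Formula n)} {φ ψ : Formula n} → T ⨾ Γ ⊢ ¬' (φ ⇒ ψ) → T ⨾ Γ ⊢ ¬' ψ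
  ¬⇒-right d = ⇒-intro (⇒-elim (weaken there d) (⇒-intro (hyp (there (here refl)))))

  -- The new membership of `C` carries a proof of `P`, which makes the extension possible without
  -- deciding `P`.
  Extended : (Closure → Set) → Closure → Set → Closure → Set
  Extended G C P C′ = G C′ ⊎ (C′ ≡ C × P)

  -- The list is finite, so inspecting it shows whether the new membership is used anywhere; a
  -- single use supplies `P`.
  split : ∀ {C P L} → All (Extended G C P) L →
          All G L ⊎ (P × Σ (List Closure) λ L′ → All G L′ × L List.⊆ C ∷ L′)
  split [] = inj₁ []
  split (inj₁ g ∷ gs) with split gs
  ... | inj₁ all = inj₁ (g ∷ all)
  ... | inj₂ (p , L′ , all , s) = inj₂ (p , _ ∷ L′ , g ∷ all , λ
    { (here refl) → there (here refl)
    ; (there x) → case-there (s x) })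
    where
    case-there : ∀ {C D E : Closure} {M} → C ∈ D ∷ M → C ∈ D ∷ E ∷ M
    case-there (here e)  = here e
    case-there (there x) = there (there x)
  split (inj₂ (refl , p) ∷ gs) with split gs
  ... | inj₁ all = inj₂ (p , _ , all , id)
  ... | inj₂ (_ , L′ , all , s) = inj₂ (p , L′ , all , λ
    { (here refl) → here refl ; (there x) → s x })

  ⊩-discharge : ∀ {P} → Extended G (φ [ ρ ]) P ⊩ ⊥ᵒ → (G ⊩ ⊥ᵒ) ⊎ (P × (G ⊩ ¬' φ [ ρ ]))
  ⊩-discharge (⊩-intro L all d) with split all
  ... | inj₁ all′ = inj₁ (⊩-intro L all′ d)
  ... | inj₂ (p , L′ , all′ , s) =
    inj₂ (p , ⊩-intro L′ all′ λ r → ⇒-intro (weaken (map⁺ (r ·_) s) (d r)))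

  -- Henkin axioms and fresh names

  Below : ℕ → Closure → Set
  Below c C = ∀ i → env C i < c

  -- The witness axiom in universal form: if `c` is not a counterexample to `φ`, then nothing is.
  henkin : Formula (suc n) → (Fin n → ℕ) → ℕ → Closure
  henkin φ ρ c = (φ ⇒ ren suc (∀' φ)) [ ρ ▸ c ]

  henkin-∀ : ∀ {c} (r : ℕ → Fin m) (φ : Formula (suc n)) →
             ren (r ∘ (ρ ▸ c)) (ren suc (∀' φ)) ≡ r · (∀' φ [ ρ ])
  henkin-∀ r φ = ren-∘ _ suc (∀' φ)

  fresh : ℕ → (ℕ → Fin m) → ℕ → Fin (suc m)
  fresh c r j with j ≟ c
  ... | yes _ = zero
  ... | no  _ = suc (r j)

  fresh-at : ∀ c (r : ℕ → Fin m) → fresh c r c ≡ zero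
  fresh-at c r with c ≟ c
  ... | yes _ = refl
  ... | no  q = ⊥-elim (q refl)

  fresh-below : ∀ {c j} (r : ℕ → Fin m) → j < c → fresh c r j ≡ suc (r j)
  fresh-below {c = c} {j} r j<c with j ≟ c
  ... | yes refl = ⊥-elim (<-irrefl refl j<c)
  ... | no  _    = refl

  fresh-below* : ∀ {c} (r : ℕ → Fin m) {L} → All (Below c) L →
                 map (fresh c r ·_) L ≡ map (ren suc) (map (r ·_) L)
  fresh-below* r [] = refl
  fresh-below* r {φ [ ρ ] ∷ L} (b ∷ bs) = cong₂ _∷_
    (trans (ren-cong (λ i → fresh-below r (b i)) φ) (sym (ren-∘ suc _ φ)))
    (fresh-below* r bs)

  -- Naming c by a bound variable turns a derivation of φ(c) into one of ∀φ.
  ⊩-generalize : ∀ {c} (φ : Formula (suc n)) → (∀ {C} → G C → Below c C) → (∀ i → ρ i < c) →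
                 G ⊩ φ [ ρ ▸ c ] → G ⊩ ∀' φ [ ρ ]
  ⊩-generalize {ρ = ρ} {c = c} φ below ρ< (⊩-intro L all d) = ⊩-intro L all λ r →
    ∀-intro (subst₂ (T ⨾_⊢_)
      (fresh-below* r (All.map below all))
      (ren-cong (λ { zero → fresh-at c r ; (suc i) → fresh-below r (ρ< i) }) φ)
      (d (fresh c r)))

  -- A refutation of the Henkin axiom yields both `φ` at `c` and the negation of `∀' φ`. Since `c`
  -- is fresh, the former generalizes and contradicts the latter.
  henkin-inconsistent : ∀ {c} (φ : Formula (suc n)) →
    (∀ {C} → G C → Below c C) → (∀ i → ρ i < c) →
    G ⊩ ¬' (φ ⇒ ren suc (∀' φ)) [ ρ ▸ c ] → G ⊩ ⊥ᵒ
  henkin-inconsistent {ρ = ρ} φ below ρ< g =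
    ⊩-map₂ (λ r → ⇒-elim)
      (⊩-map {C′ = ¬' (∀' φ) [ ρ ]}
        (λ r {Γ} d → subst (λ χ → T ⨾ Γ ⊢ ¬' χ) (henkin-∀ r φ) (¬⇒-right d)) g)
      (⊩-generalize φ below ρ< (⊩-map (λ r → ¬⇒-left) g))

  -- The Henkin extension of the negation of `σ`

  module Saturation (σ : Sentence) where

    Initial : Closure → Set
    Initial C = C ≡ ¬' σ [ ∅ᵉ ]

    -- This set becomes the truth value `⊥` of the term model; by `refute` it yields a derivation of
    -- `σ`.
    Inconsistent : Set
    Inconsistent = Initial ⊩ ⊥ᵒ

    record Stage : Set₁ where
      field
        theory     : Closure → Set
        bound      : ℕ
        below      : ∀ {C} → theory C → Below bound C
        consistent : theory ⊩ ⊥ᵒ → Inconsistent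
    open Stage

    admit : Formula (suc n) → Stage → Stage
    admit φ s .theory = Extended (theory s) (φ [ toℕ ]) (theory s ⊩ ¬' φ [ toℕ ] → Inconsistent)
    admit {n} φ s .bound = bound s ⊔ suc n
    admit {n} φ s .below (inj₁ g) i = ≤-trans (below s g i) (m≤m⊔n _ _)
    admit {n} φ s .below (inj₂ (refl , _)) i = ≤-trans (toℕ<n i) (m≤n⊔m (bound s) _)
    admit φ s .consistent g with ⊩-discharge g
    ... | inj₁ h       = consistent s h
    ... | inj₂ (p , h) = p h

    witness : (φ : Formula (suc n)) (s : Stage) → n < bound s → Stage
    witness φ s n< .theory = Extended (theory s) (henkin φ toℕ (bound s)) ⊤
    witness φ s n< .bound  = suc (bound s)
    witness φ s n< .below (inj₁ g) i = m<n⇒m<1+n (below s g i)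
    witness φ s n< .below (inj₂ (refl , _)) zero    = ≤-refl
    witness φ s n< .below (inj₂ (refl , _)) (suc i) = m<n⇒m<1+n (<-trans (toℕ<n i) n<)
    witness φ s n< .consistent g with ⊩-discharge g
    ... | inj₁ h       = consistent s h
    ... | inj₂ (_ , h) = consistent s
      (henkin-inconsistent φ (below s) (λ i → <-trans (toℕ<n i) n<) h)

    -- Each formula is treated in two roles: as a candidate for admission, its variables named by
    -- their indices, and as the body of a quantifier whose variable receives a fresh name.
    step : Formula (suc n) → Stage → Stage
    step φ s = witness φ (admit φ s) (m≤n⊔m (bound s) _)

    run : List (Formula (suc n)) → Stage → Stage
    run []      s = s
    run (φ ∷ l) s = run l (step φ s)

    run-mono : (l : List (Formula (suc n))) → ∀ {s C} → theory s C → theory (run l s) C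
    run-mono []      g = g
    run-mono (φ ∷ l) g = run-mono l (inj₁ (inj₁ g))

    run-reaches : ∀ {l} {φ : Formula (suc n)} → φ ∈ l → ∀ s → Σ Stage λ s′ →
                  ∀ {C} → theory (step φ s′) C → theory (run l s) C
    run-reaches {l = φ ∷ l} (here refl) s = s , run-mono l
    run-reaches {l = φ ∷ l} (there x)   s = run-reaches x (step φ s)

    stage : ℕ → Stage
    stage zero .theory = Initial
    stage zero .bound  = 0
    stage zero .below refl ()
    stage zero .consistent g = g
    -- Depth and number of names grow together, so every closure is treated eventually, up to a
    -- renaming of its variables.
    stage (suc d) = run (formulas d (suc d)) (stage d)

    Limit : Closure → Set
    Limit C = Σ ℕ λ d → theory (stage d) C

    stage-mono : ∀ {d e} → d ≤ e → ∀ {C} → theory (stage d) C → theory (stage e) C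
    stage-mono d≤e g = go (≤⇒≤′ d≤e) g
      where
      go : ∀ {d e} → d ≤′ e → ∀ {C} → theory (stage d) C → theory (stage e) C
      go ≤′-refl g = g
      go (≤′-step {e} p) g = run-mono (formulas e (suc e)) (go p g)

    limit-compact : ∀ {L} → All Limit L → Σ ℕ λ d → All (theory (stage d)) L
    limit-compact [] = 0 , []
    limit-compact ((d , g) ∷ gs) with limit-compact gs
    ... | e , all = d ⊔ e , stage-mono (m≤m⊔n d e) g ∷ All.map (stage-mono (m≤n⊔m d e)) all

    limit-consistent : Limit ⊩ ⊥ᵒ → Inconsistent
    limit-consistent (⊩-intro L all d) with limit-compact all
    ... | e , all′ = consistent (stage e) (⊩-intro L all′ d)

    limit-reaches : ∀ {d} {φ : Formula (suc d)} → φ ∈ formulas d (suc d) → Σ Stage λ s →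
                    ∀ {C} → theory (step φ s) C → Limit C
    limit-reaches {d} x with run-reaches x (stage d)
    ... | s , f = s , λ g → suc d , f g

    -- Admission only concerns refutations from the current stage, and these are also refutations
    -- from the limit.
    limit-admits : ∀ {d} {φ : Formula (suc d)} → φ ∈ formulas d (suc d) →
                   (Limit ⊩ ¬' φ [ toℕ ] → Inconsistent) → Limit (φ [ toℕ ])
    limit-admits x c with limit-reaches x
    ... | s , f = f (inj₁ (inj₂ (refl , λ g → c (⊩-mono (λ h → f (inj₁ (inj₁ h))) g))))

    limit-witness : ∀ {d} {φ : Formula (suc d)} → φ ∈ formulas d (suc d) →
                    Σ ℕ λ c → Limit (henkin φ toℕ c)
    limit-witness x with limit-reaches x
    ... | s , f = _ , f (inj₂ (refl , tt))

    ⊩-maximal : (φ : Formula o) (ρ : Fin o → ℕ) →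
                (Limit ⊩ ¬' φ [ ρ ] → Inconsistent) → Limit ⊩ φ [ ρ ]
    ⊩-maximal φ ρ c with strictBound ρ
    ... | b , ρ< = ⊩-transport same (⊩-hyp (limit-admits
            (∈-formulas φ′ (≤-trans (≤-reflexive (depth-ren _ φ)) (m≤m⊔n _ _)))
            (λ g → c (⊩-transport (λ r → cong ¬' (same r)) g))))
      where
      -- `d` bounds both the depth of `φ` and the names in `ρ`. Using the names as variable indices
      -- gives a closure with environment `toℕ`, as treated by the stages.
      d  = depth φ ⊔ b
      ρ<d : ∀ i → ρ i < suc d
      ρ<d i = m<n⇒m<1+n (≤-trans (ρ< i) (m≤n⊔m (depth φ) b))
      φ′ = ren (λ i → fromℕ< (ρ<d i)) φ
      same : ∀ {m} (r : ℕ → Fin m) → r · (φ′ [ toℕ ]) ≡ r · (φ [ ρ ])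
      same r = trans (ren-∘ _ _ φ) (ren-cong (λ i → cong r (toℕ-fromℕ< (ρ<d i))) φ)

    -- This is the contrapositive of a Henkin axiom, which the limit contains once the variables of
    -- `φ` other than the quantified one are renamed to match `toℕ`.
    ⊩-counterexample : (φ : Formula (suc o)) (ρ : Fin o → ℕ) → Limit ⊩ ¬' (∀' φ) [ ρ ] →
                       Σ ℕ λ c → Limit ⊩ ¬' φ [ ρ ▸ c ]
    ⊩-counterexample φ ρ g with strictBound ρ
    ... | b , ρ< with limit-witness
                        (∈-formulas φ′ (≤-trans (≤-reflexive (depth-ren _ φ)) (m≤m⊔n _ b)))
      where
      ρ<d : ∀ i → ρ i < depth φ ⊔ b
      ρ<d i = ≤-trans (ρ< i) (m≤n⊔m (depth φ) b)
      φ′ = ren (lift 1 (λ i → fromℕ< (ρ<d i))) φ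
    ... | c , h = c , ⊩-map₂
                        (λ r e d → contrapositive (⇒-elim (weaken there e) (hyp (here refl))) d)
                        (⊩-transport {C′ = (φ ⇒ ren suc (∀' φ)) [ ρ ▸ c ]} (λ r → cong₂ _⇒_
                          (trans (ren-∘ _ _ φ) (ren-cong (same r) φ))
                          (trans (ren-∘ _ suc (∀' _)) (trans (ren-∘ _ _ (∀' φ))
                            (trans (ren-cong (same r ∘ suc) (∀' φ)) (sym (ren-∘ _ suc (∀' φ)))))))
                          (⊩-hyp h))
                        (⊩-transport {C′ = ¬' (ren suc (∀' φ)) [ ρ ▸ c ]}
                          (λ r → cong ¬' (sym (henkin-∀ r φ))) g)
      where
      ρ<d : ∀ i → ρ i < depth φ ⊔ b
      ρ<d i = ≤-trans (ρ< i) (m≤n⊔m (depth φ) b)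
      same : ∀ {m} (r : ℕ → Fin m) i →
             r ((toℕ ▸ c) (lift 1 (λ i → fromℕ< (ρ<d i)) i)) ≡ r ((ρ ▸ c) i)
      same r zero    = refl
      same r (suc i) = cong r (toℕ-fromℕ< (ρ<d i))

    ⊩-stable : (φ : Formula o) (ρ : Fin o → ℕ) →
               ((Limit ⊩ φ [ ρ ] → Inconsistent) → Inconsistent) → Limit ⊩ φ [ ρ ]
    ⊩-stable φ ρ nn = ⊩-maximal φ ρ λ n → nn λ p → limit-consistent (⊩-map₂ (λ r → ⇒-elim) n p)

    inconsistent-⊩ : ∀ {C} → Inconsistent → Limit ⊩ C
    inconsistent-⊩ x = ⊩-map (λ r → ex-falso) (⊩-mono (λ g → 0 , g) x)

    -- The term model

    names : ℕ → ℕ → Fin 2 → ℕ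
    names x y = ∅ᵉ ▸ y ▸ x

    ⊩-subst : (φ : Formula (suc o)) {ρ : Fin o → ℕ} → ∀ {x y} →
              Limit ⊩ (v0 ≐ v1) [ names x y ] → Limit ⊩ φ [ ρ ▸ x ] → Limit ⊩ φ [ ρ ▸ y ]
    ⊩-subst φ {ρ} = ⊩-map₂ λ r e d →
      subst (T ⨾ _ ⊢_) (inst-ren r _ φ)
        (≐-subst (ren (lift 1 (r ∘ ρ)) φ) e (subst (T ⨾ _ ⊢_) (sym (inst-ren r _ φ)) d))
      where
      inst-ren : (r : ℕ → Fin m) → ∀ x φ →
                 ren (inst (r x)) (ren (lift 1 (r ∘ ρ)) φ) ≡ r · (φ [ ρ ▸ x ])
      inst-ren r x φ = trans (ren-∘ _ _ φ) (ren-cong (λ { zero → refl ; (suc i) → refl }) φ)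

    termModel : Structure
    termModel = record
      { Dom = ℕ
      ; _∈ₛ_ = λ x y → Limit ⊩ (v0 ε v1) [ names x y ]
      ; _≈_ = λ x y → Limit ⊩ (v0 ≐ v1) [ names x y ]
      ; ⊥ = Inconsistent
      ; ∈-stable = ⊩-stable _ _
      ; ≈-stable = ⊩-stable _ _
      ; ≈-refl = ⊩-intro [] [] (λ r → ≐-refl)
      ; ≈-substˡ = λ {x} {y} {z} → ⊩-subst (v0 ε v1) {∅ᵉ ▸ z}
      ; ≈-substʳ = λ {x} {y} {z} e →
          ⊩-transport (λ r → refl) ∘ ⊩-subst (v1 ε v0) {∅ᵉ ▸ z} e ∘ ⊩-transport (λ r → refl)
      ; ≈-euclid = λ {x} {y} {z} e → ⊩-subst (v0 ≐ v1) {∅ᵉ ▸ z} e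
      }

    open Structure termModel using (⟦_⟧; ⊨_)

    -- The two directions depend on each other because an implication is contravariant in its
    -- premise. For `⇒` and `∀'`, `truth` uses maximality: a derivation of the negation is turned
    -- into inconsistency.
    truth  : (φ : Formula o) (ρ : Fin o → ℕ) → ⟦ φ ⟧ ρ → Limit ⊩ φ [ ρ ]
    truth⁻ : (φ : Formula o) (ρ : Fin o → ℕ) → Limit ⊩ φ [ ρ ] → ⟦ φ ⟧ ρ

    truth (x ε y) ρ p = ⊩-transport (λ r → refl) p
    truth (x ≐ y) ρ p = ⊩-transport (λ r → refl) p
    truth ⊥'      ρ p = inconsistent-⊩ p
    truth (φ ⇒ ψ) ρ p = ⊩-maximal (φ ⇒ ψ) ρ λ n →
      limit-consistent (⊩-map₂ (λ r → ⇒-elim)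
        (⊩-map {C′ = ¬' ψ [ ρ ]} (λ r → ¬⇒-right) n)
        (truth ψ ρ (p (truth⁻ φ ρ (⊩-map (λ r → ¬⇒-left) n)))))
    truth (∀' φ) ρ p = ⊩-maximal (∀' φ) ρ λ n → let c , q = ⊩-counterexample φ ρ n in
      limit-consistent (⊩-map₂ (λ r → ⇒-elim) q (truth φ (ρ ▸ c) (p c)))

    truth⁻ (x ε y) ρ p = ⊩-transport (λ r → refl) p
    truth⁻ (x ≐ y) ρ p = ⊩-transport (λ r → refl) p
    truth⁻ ⊥'      ρ p = limit-consistent (⊩-transport (λ r → refl) p)
    truth⁻ (φ ⇒ ψ) ρ p q = truth⁻ ψ ρ (⊩-map₂ (λ r → ⇒-elim) p (truth φ ρ q))
    truth⁻ (∀' φ)  ρ p c = truth⁻ φ (ρ ▸ c) (⊩-map (λ r d →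
      subst (T ⨾ _ ⊢_)
        (trans (ren-∘ _ _ φ) (ren-cong (λ { zero → refl ; (suc i) → refl }) φ))
        (∀-elim d (r c))) p)

    termModel-⊨ : ∀ {τ} → T τ → ⊨ τ
    termModel-⊨ {τ} t = truth⁻ τ ∅ᵉ (⊩-intro [] [] λ r →
      subst (T ⨾ _ ⊢_) (ren-cong (λ ()) τ) (axiom t))

    refute : Inconsistent → T ⊢ σ
    -- Names are interpreted by variables, and a sentence has none in scope; `nonempty` provides
    -- one, which interprets every name.
    refute (⊩-intro L all d) = raa (⇒-elim nonempty (∀-intro (⇒-intro
      (⇒-elim (hyp (there (here refl)))
        (weaken (λ ()) (subst (T ⨾ [] ⊢_) (ren-cong (λ ()) σ)
          (raa (weaken (map⁺ (r ·_) (only all)) (d r)))))))))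
      where
      r : ℕ → Fin 1
      r _ = zero
      only : ∀ {L} → All Initial L → L List.⊆ ¬' σ [ ∅ᵉ ] ∷ []
      only (refl ∷ all) (here e)  = here e
      only (refl ∷ all) (there x) = only all x

  -- The term model satisfies `T`, hence `σ`, so the limit derives `σ` besides its negation;
  -- relative consistency converts this into a derivation of `σ`.
  completeness : ∀ {σ} → Entails T σ → T ⊢ σ
  completeness {σ} valid = refute (limit-consistent (⊩-map₂ (λ r → ⇒-elim)
      (⊩-mono (λ g → 0 , g) (⊩-hyp refl))
      (truth σ ∅ᵉ (valid termModel termModel-⊨))))
    where open Saturation σ

-- Set theory in a structure

module Logic (𝓜 : Structure) where
  open Structure 𝓜

  infix  4 _⇔_
  infixr 7 _∧_
  infixr 6 _∨_

  ¬_ : Set → Set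
  ¬ A = A → ⊥
  infix 8 ¬_

  _∧_ _∨_ _⇔_ : Set → Set → Set
  A ∧ B = ¬ (A → ¬ B)
  A ∨ B = ¬ A → B
  A ⇔ B = (A → B) ∧ (B → A)

  EX : (Dom → Set) → Set
  EX P = ¬ (∀ d → ¬ (P d))

  -- As `⊥` is arbitrary, classical reasoning applies only to goals closed under this double
  -- negation. Instance search builds the closure up from the atoms.
  record Stable (A : Set) : Set where
    constructor stable
    field stab : ¬ ¬ A → A
  open Stable {{...}} public

  instance
    Stable-⊥ : Stable ⊥
    Stable-⊥ = stable λ f → f id
    Stable-∈ : ∀ {x y} → Stable (x ∈ₛ y)
    Stable-∈ = stable ∈-stable
    Stable-≈ : ∀ {x y} → Stable (x ≈ y)
    Stable-≈ = stable ≈-stable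
    Stable-Π : {B : A → Set} {{s : ∀ {x} → Stable (B x)}} → Stable (∀ x → B x)
    Stable-Π {{s}} = stable λ f x → stab {{s}} λ g → f λ h → g (h x)

  infixl 1 _>>=_
  -- Both EX and _∧_ are double negations of a Σ-type.
  _>>=_ : {B : A → Set} {{s : Stable C}} → ¬ (∀ a → ¬ (B a)) → (Σ A B → C) → C
  e >>= f = stab λ g → e λ a b → g (f (a , b))

  exfalso : {{s : Stable A}} → ⊥ → A
  exfalso x = stab λ _ → x

  infixr 4 _&_
  _&_ : A → B → A ∧ B
  (a & b) k = k a b

  ex : {P : Dom → Set} (x : Dom) → P x → EX P
  ex x p k = k x p

  fst : {{s : Stable A}} → A ∧ B → A
  fst p = stab λ g → p λ a _ → g a

  snd : {{s : Stable B}} → A ∧ B → B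
  snd p = stab λ g → p λ _ b → g b

  inl : {{s : Stable B}} → A → A ∨ B
  inl a n = exfalso (n a)

  inr : B → A ∨ B
  inr b _ = b

  or : {{s : Stable C}} → A ∨ B → (A → C) → (B → C) → C
  or p f g = stab λ n → n (g (p λ a → n (f a)))

  em : {{s : Stable C}} → (A → C) → (¬ A → C) → C
  em f g = stab λ n → n (g λ a → n (f a))

  to : {{s : Stable B}} → A ⇔ B → A → B
  to p a = stab λ n → p λ f _ → n (f a)

  from : {{s : Stable A}} → A ⇔ B → B → A
  from p b = stab λ n → p λ _ g → n (g b)

  ≈-sym : ∀ {x y} → x ≈ y → y ≈ x
  ≈-sym e = ≈-euclid e ≈-refl

  ≈-trans : ∀ {x y z} → x ≈ y → y ≈ z → x ≈ z
  ≈-trans e f = ≈-euclid (≈-sym e) f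

  _≋_ : (ρ ρ′ : Fin n → Dom) → Set
  ρ ≋ ρ′ = ∀ i → ρ i ≈ ρ′ i

  infixl 5 _▸≈_
  _▸≈_ : {ρ ρ′ : Fin n → Dom} → ρ ≋ ρ′ → ∀ {x y} → x ≈ y → (ρ ▸ x) ≋ (ρ′ ▸ y)
  (e ▸≈ f) zero    = f
  (e ▸≈ f) (suc i) = e i

  ≋-sym : {ρ ρ′ : Fin n → Dom} → ρ ≋ ρ′ → ρ′ ≋ ρ
  ≋-sym e i = ≈-sym (e i)

  resp : (φ : Formula n) {ρ ρ′ : Fin n → Dom} → ρ ≋ ρ′ → ⟦ φ ⟧ ρ → ⟦ φ ⟧ ρ′
  resp (x ε y) e p = ≈-substʳ (e y) (≈-substˡ (e x) p)
  resp (x ≐ y) e p = ≈-euclid (e x) (≈-trans p (e y))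
  resp ⊥'      e p = p
  resp (φ ⇒ ψ) e p q = resp ψ e (p (resp φ (≋-sym e) q))
  resp (∀' φ)  e p d = resp φ (e ▸≈ ≈-refl) (p d)

  lift-▸ : {f : Fin m → Fin n} {ρ : Fin n → Dom} {ρ′ : Fin m → Dom} → (ρ ∘ f) ≋ ρ′ →
           ∀ d → ((ρ ▸ d) ∘ lift 1 f) ≋ (ρ′ ▸ d)
  lift-▸ e d zero    = ≈-refl
  lift-▸ e d (suc i) = e i

  ren-to   : (φ : Formula m) {f : Fin m → Fin n} {ρ : Fin n → Dom} {ρ′ : Fin m → Dom} →
             (ρ ∘ f) ≋ ρ′ → ⟦ ren f φ ⟧ ρ → ⟦ φ ⟧ ρ′
  ren-from : (φ : Formula m) {f : Fin m → Fin n} {ρ : Fin n → Dom} {ρ′ : Fin m → Dom} →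
             (ρ ∘ f) ≋ ρ′ → ⟦ φ ⟧ ρ′ → ⟦ ren f φ ⟧ ρ
  ren-to (x ε y) e p = ≈-substʳ (e y) (≈-substˡ (e x) p)
  ren-to (x ≐ y) e p = ≈-euclid (e x) (≈-trans p (e y))
  ren-to ⊥'      e p = p
  ren-to (φ ⇒ ψ) e p q = ren-to ψ e (p (ren-from φ e q))
  ren-to (∀' φ)  e p d = ren-to φ (lift-▸ e d) (p d)
  ren-from (x ε y) e p = ≈-substʳ (≈-sym (e y)) (≈-substˡ (≈-sym (e x)) p)
  ren-from (x ≐ y) e p = ≈-trans (e x) (≈-trans p (≈-sym (e y)))
  ren-from ⊥'      e p = p
  ren-from (φ ⇒ ψ) e p q = ren-from ψ e (p (ren-to φ e q))
  ren-from (∀' φ)  e p d = ren-from φ (lift-▸ e d) (p d)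

  ∀*-from : (φ : Formula n) → (∀ ρ → ⟦ φ ⟧ ρ) → ⊨ ∀* φ
  ∀*-from {zero}  φ p = p ∅ᵉ
  ∀*-from {suc n} φ p = ∀*-from (∀' φ) λ ρ d → p (ρ ▸ d)

-- Pairs, successors and values of terms

module SetTheory (𝓜 : Structure)
  (⊨BST : ∀ {τ} → BST τ → Structure.⊨_ 𝓜 τ) where

  open Structure 𝓜 public
  open Logic 𝓜 public

  private variable
    a b k p q s t u v w x y z : Dom

  _⊆_ : Dom → Dom → Set
  x ⊆ y = ∀ z → z ∈ₛ x → z ∈ₛ y

  extensional : (∀ z → z ∈ₛ x ⇔ z ∈ₛ y) → x ≈ y
  extensional {x} {y} = ⊨BST ext x y

  Empty : Dom → Set
  Empty x = ∀ y → ¬ (y ∈ₛ x)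

  -- `UPair` and `IsPr` agree by computation with the interpretations of `IsUPair` and `IsPair`, and
  -- `Adj y x x` with that of `IsSuc`, so axioms and `resp` apply to them directly.
  UPair IsPr Adj : Dom → Dom → Dom → Set
  UPair z x y = ∀ w → w ∈ₛ z ⇔ (w ≈ x ∨ w ≈ y)
  IsPr z x y  = EX λ a → UPair a x x ∧ EX λ b → UPair b x y ∧ UPair z a b
  Adj z x y   = ∀ w → w ∈ₛ z ⇔ (w ∈ₛ x ∨ w ≈ y)

  IsS : Dom → Dom → Set
  IsS y x = Adj y x x

  upair-ex : ∀ x y → EX λ z → UPair z x y
  upair-ex = ⊨BST pair

  pair-ex : ∀ x y → EX λ z → IsPr z x y
  pair-ex x y = do
    (a , pa) ← upair-ex x x
    (b , pb) ← upair-ex x y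
    (z , pz) ← upair-ex a b
    ex z (ex a (pa & ex b (pb & pz)))

  -- The set is obtained as the union of `{x , {y}}`.
  adj-ex : ∀ x y → EX λ z → Adj z x y
  adj-ex x y = do
    (p , pp) ← upair-ex y y
    (q , pq) ← upair-ex x p
    (u , pu) ← ⊨BST union q
    ex u λ w →
      (λ w∈u → do
        (v , pv) ← to (pu w) w∈u
        (v∈q , w∈v) ← pv
        or (to (pq v) v∈q)
          (λ v≈x → inl (≈-substʳ v≈x w∈v))
          (λ v≈p → inr (or (to (pp w) (≈-substʳ v≈p w∈v)) id id)))
      & λ c → or c
          (λ w∈x → from (pu w) (ex x (from (pq x) (inl ≈-refl) & w∈x)))
          (λ w≈y → from (pu w) (ex p (from (pq p) (inr ≈-refl) & from (pp w) (inl w≈y))))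

  resp₃ : (φ : Formula 3) → x ≈ u → y ≈ v → z ≈ w →
          ⟦ φ ⟧ (∅ᵉ ▸ z ▸ y ▸ x) → ⟦ φ ⟧ (∅ᵉ ▸ w ▸ v ▸ u)
  resp₃ φ e₁ e₂ e₃ = resp φ ((λ ()) ▸≈ e₃ ▸≈ e₂ ▸≈ e₁)

  IsPr-resp : x ≈ u → y ≈ v → z ≈ w → IsPr x y z → IsPr u v w
  IsPr-resp = resp₃ (IsPair v0 v1 v2)

  UPair-uniq : UPair a x y → UPair b x y → a ≈ b
  UPair-uniq pa pb = extensional λ w →
    (λ q → from (pb w) (to (pa w) q)) & λ q → from (pa w) (to (pb w) q)

  UPair-resp : x ≈ u → y ≈ v → z ≈ w → UPair x y z → UPair u v w
  UPair-resp = resp₃ (IsUPair v0 v1 v2)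

  IsPr-uniq : IsPr z x y → IsPr w x y → z ≈ w
  IsPr-uniq pz pw = do
    (a , p) ← pz
    (pa , p) ← p
    (b , p) ← p
    (pb , pz) ← p
    (a′ , p) ← pw
    (pa′ , p) ← p
    (b′ , p) ← p
    (pb′ , pw) ← p
    UPair-uniq pz (UPair-resp ≈-refl (UPair-uniq pa′ pa) (UPair-uniq pb′ pb) pw)

  IsPr-injˡ : IsPr z x y → IsPr z u v → x ≈ u
  IsPr-injˡ {u = u} pz pw = do
    (a , p) ← pz
    (pa , p) ← p
    (b , p) ← p
    (pb , pz) ← p
    (a′ , p) ← pw
    (pa′ , p) ← p
    (b′ , p) ← p
    (pb′ , pw) ← p
    or (to (pw a) (from (pz a) (inl ≈-refl)))
      (λ a≈a′ → u∈a→ pa (≈-substʳ (≈-sym a≈a′) (from (pa′ u) (inl ≈-refl))))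
      (λ a≈b′ → u∈a→ pa (≈-substʳ (≈-sym a≈b′) (from (pb′ u) (inl ≈-refl))))
    where
    u∈a→ : UPair a x x → u ∈ₛ a → x ≈ u
    u∈a→ pa u∈a = ≈-sym (or (to (pa _) u∈a) id id)

  IsPr-injʳ : IsPr z x y → IsPr z u v → y ≈ v
  IsPr-injʳ {x = x} {y = y} {u = u} {v = v} pz₀ pw₀ = do
    (a , p) ← pz₀
    (pa , p) ← p
    (b , p) ← p
    (pb , pz) ← p
    (a′ , p) ← pw₀
    (pa′ , p) ← p
    (b′ , p) ← p
    (pb′ , pw) ← p
    let y∈b = from (pb y) (inr ≈-refl)
        v∈b′ = from (pb′ v) (inr ≈-refl)
        -- The degenerate case, in which all four components coincide.
        collapse : v ≈ x → y ≈ u → y ≈ v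
        collapse v≈x y≈u = ≈-trans y≈u (≈-trans (≈-sym x≈u) (≈-sym v≈x))
        v≈x→ : v ≈ x → y ≈ v
        v≈x→ v≈x = or (to (pw b) (from (pz b) (inr ≈-refl)))
          (λ b≈a′ → collapse v≈x (or (to (pa′ y) (≈-substʳ b≈a′ y∈b)) id id))
          (λ b≈b′ → or (to (pb′ y) (≈-substʳ b≈b′ y∈b)) (collapse v≈x) id)
    or (to (pz b′) (from (pw b′) (inr ≈-refl)))
      (λ b′≈a → v≈x→ (or (to (pa v) (≈-substʳ b′≈a v∈b′)) id id))
      (λ b′≈b → or (to (pb v) (≈-substʳ b′≈b v∈b′)) v≈x→ ≈-sym)
    where
    x≈u : x ≈ u
    x≈u = IsPr-injˡ pz₀ pw₀

  Adj-uniq : Adj a x y → Adj b x y → a ≈ b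
  Adj-uniq pa pb = extensional λ w →
    (λ q → from (pb w) (to (pa w) q)) & λ q → from (pa w) (to (pb w) q)

  IsS-resp : x ≈ y → u ≈ v → IsS x u → IsS y v
  IsS-resp {x} {y} {u} {v} e f = resp₃ {z = x} {w = y} (IsSuc v0 v1) e f e

  Is : (Fin m → Dom) → Dom → Tm m → Set
  Is e x (` i)     = x ≈ e i
  Is e x ∅         = Empty x
  Is e x (sucᵗ t)  = EX λ a → Is e a t ∧ IsS x a
  Is e x ⟨ t , u ⟩ = EX λ a → Is e a t ∧ EX λ b → Is e b u ∧ IsPr x a b

  isᵉ-from : ∀ {σ : Fin m → Fin n} {ρ x} t → Is (ρ ∘ σ) (ρ x) t → ⟦ isᵉ σ x t ⟧ ρ
  isᵉ-from (` i)       p = p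
  isᵉ-from ∅           p = p
  isᵉ-from (sucᵗ t)    p k = p λ a q → q λ r s → k a (isᵉ-from t r & s)
  isᵉ-from ⟨ t , u ⟩   p k = p λ a q → q λ r q′ → q′ λ b q″ → q″ λ r′ s →
                             k a (isᵉ-from t r & ex b (isᵉ-from u r′ & s))

  Is-ex : ∀ {e : Fin m → Dom} t → EX λ x → Is e x t
  Is-ex {e = e} (` i) = ex (e i) ≈-refl
  Is-ex ∅ = ⊨BST empty
  Is-ex (sucᵗ t) = do
    (a , pa) ← Is-ex t
    (x , px) ← adj-ex a a
    ex x (ex a (pa & px))
  Is-ex ⟨ t , u ⟩ = do
    (a , pa) ← Is-ex t
    (b , pb) ← Is-ex u
    (x , px) ← pair-ex a b
    ex x (ex a (pa & ex b (pb & px)))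

  Is-resp : ∀ {e : Fin m → Dom} t → x ≈ y → Is e x t → Is e y t
  Is-resp (` i) x≈y p = ≈-euclid x≈y p
  Is-resp ∅ x≈y p z z∈y = p z (≈-substʳ (≈-sym x≈y) z∈y)
  Is-resp (sucᵗ t) x≈y p k = p λ a q → q λ r s → k a (r & IsS-resp x≈y ≈-refl s)
  Is-resp ⟨ t , u ⟩ x≈y p k = p λ a q → q λ r q′ → q′ λ b q″ → q″ λ r′ s →
                               k a (r & ex b (r′ & IsPr-resp x≈y ≈-refl ≈-refl s))

  Is-uniq : ∀ {e : Fin m → Dom} t → Is e x t → Is e y t → x ≈ y
  Is-uniq (` i) p q = ≈-trans p (≈-sym q)
  Is-uniq ∅ p q = extensional λ w → (λ r → exfalso (p w r)) & λ r → exfalso (q w r)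
  Is-uniq (sucᵗ t) p q = do
    (a , p) ← p
    (pa , ps) ← p
    (b , q) ← q
    (qb , qs) ← q
    Adj-uniq ps (IsS-resp ≈-refl (Is-uniq t qb pa) qs)
  Is-uniq ⟨ t , u ⟩ p q = do
    (a , p) ← p
    (pa , p) ← p
    (b , p) ← p
    (pb , ps) ← p
    (a′ , q) ← q
    (qa , q) ← q
    (b′ , q) ← q
    (qb , qs) ← q
    IsPr-uniq ps (IsPr-resp ≈-refl (Is-uniq t qa pa) (Is-uniq u qb pb) qs)

  sub : (Fin m → Tm n) → Tm m → Tm n
  sub θ (` i)     = θ i
  sub θ ∅         = ∅
  sub θ (sucᵗ t)  = sucᵗ (sub θ t)
  sub θ ⟨ t , u ⟩ = ⟨ sub θ t , sub θ u ⟩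

  module _ {e : Fin n → Dom} {e′ : Fin m → Dom} {θ : Fin m → Tm n}
    (val : ∀ i → Is e (e′ i) (θ i)) where

    -- With `sub-from`, this is the substitution lemma for terms. It allows a closed code to be read
    -- as a term in variables that stand for its parts.
    sub-to : ∀ t {x} → Is e x (sub θ t) → Is e′ x t
    sub-to (` i) p = Is-uniq (θ i) p (val i)
    sub-to ∅ p = p
    sub-to (sucᵗ t)  p k = p λ a q → q λ r s → k a (sub-to t r & s)
    sub-to ⟨ t , u ⟩ p k = p λ a q → q λ r q′ → q′ λ b q″ → q″ λ r′ s →
                             k a (sub-to t r & ex b (sub-to u r′ & s))

    sub-from : ∀ t {x} → Is e′ x t → Is e x (sub θ t)
    sub-from (` i) p = Is-resp (θ i) (≈-sym p) (val i)
    sub-from ∅ p = p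
    sub-from (sucᵗ t)  p k = p λ a q → q λ r s → k a (sub-from t r & s)
    sub-from ⟨ t , u ⟩ p k = p λ a q → q λ r q′ → q′ λ b q″ → q″ λ r′ s →
                               k a (sub-from t r & ex b (sub-from u r′ & s))


-- Functions as sets of ordered pairs

module Functions (𝓜 : Structure)
  (⊨BST : ∀ {τ} → BST τ → Structure.⊨_ 𝓜 τ) where

  open SetTheory 𝓜 ⊨BST public

  private variable
    a b d g g′ h i k k′ M N p s s′ u v x y z : Dom

  infix 9 [_,_]∈_
  [_,_]∈_ : Dom → Dom → Dom → Set
  [ x , y ]∈ g = EX λ z → z ∈ₛ g ∧ IsPr z x y

  []∈-mono : g ⊆ g′ → [ x , y ]∈ g → [ x , y ]∈ g′
  []∈-mono s p k = p λ z q → q λ r t → k z (s z r & t)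

  []∈-resp : x ≈ u → y ≈ v → [ x , y ]∈ g → [ u , v ]∈ g
  []∈-resp e f p k = p λ z q → q λ r t → k z (r & IsPr-resp ≈-refl e f t)

  -- ⟨ t , u ⟩ ∈ᵗ g, for P and Q the predicates "is t" and "is u"
  PairIn : (Dom → Set) → (Dom → Set) → Dom → Set
  PairIn P Q g = EX λ z → z ∈ₛ g ∧ EX λ a → P a ∧ EX λ b → Q b ∧ IsPr z a b

  pairIn-to : {P Q : Dom → Set} → (∀ {z} → P z → z ≈ x) → (∀ {z} → Q z → z ≈ y) →
              PairIn P Q g → [ x , y ]∈ g
  pairIn-to f h p = do
    (z , p) ← p
    (z∈g , p) ← p
    (a , p) ← p
    (pa , p) ← p
    (b , p) ← p
    (pb , p) ← p
    ex z (z∈g & IsPr-resp ≈-refl (f pa) (h pb) p)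

  pairIn-from : {P Q : Dom → Set} → P x → Q y → [ x , y ]∈ g → PairIn P Q g
  pairIn-from px py p k = p λ z q → q λ r t → k z (r & ex _ (px & ex _ (py & t)))

  [_,_]∈′_ : Dom → Dom → Dom → Set
  [ x , y ]∈′ g = PairIn (_≈ x) (_≈ y) g

  ∈′-to : [ x , y ]∈′ g → [ x , y ]∈ g
  ∈′-to = pairIn-to id id

  ∈′-from : [ x , y ]∈ g → [ x , y ]∈′ g
  ∈′-from = pairIn-from ≈-refl ≈-refl

  record FunOn (s k M : Dom) : Set where
    field
      pairs : ∀ p → p ∈ₛ s → EX λ i → EX λ a → i ∈ₛ k ∧ a ∈ₛ M ∧ IsPr p i a
      value : ∀ i → i ∈ₛ k → EX λ a → [ i , a ]∈ s
      functional : ∀ {i a b} → [ i , a ]∈ s → [ i , b ]∈ s → a ≈ b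

    dom-cod : [ i , a ]∈ s → i ∈ₛ k ∧ a ∈ₛ M
    dom-cod ia = do
      (p , r) ← ia
      (p∈s , r) ← r
      (j , q) ← pairs p p∈s
      (b , q) ← q
      (j∈k , q) ← q
      (b∈M , q) ← q
      ≈-substˡ (IsPr-injˡ q r) j∈k & ≈-substˡ (IsPr-injʳ q r) b∈M

    dom : [ i , a ]∈ s → i ∈ₛ k
    dom p = fst (dom-cod p)

    cod : [ i , a ]∈ s → a ∈ₛ M
    cod p = snd (dom-cod p)
  open FunOn public

  IsMap : Dom → Dom → Dom → Set
  IsMap s k M = ⟦ Map v0 v1 v2 ⟧ (∅ᵉ ▸ M ▸ k ▸ s)

  map-to : IsMap s k M → FunOn s k M
  map-to {s} {k} {M} p = record
    { pairs = pairs′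
    ; value = λ i i∈k → do
        (_ , val) ← p
        (a , q) ← val i i∈k
        ex a (∈′-to (from (q a) ≈-refl))
    ; functional = functional′ }
    where
    pairs′ : ∀ p → p ∈ₛ s → EX λ i → EX λ a → i ∈ₛ k ∧ a ∈ₛ M ∧ IsPr p i a
    pairs′ z z∈s = do
      (prs , _) ← p
      (i , r) ← prs z z∈s
      (i∈k , r) ← r
      (a , r) ← r
      (a∈M , r) ← r
      (i′ , r) ← r
      (i′≈i , r) ← r
      (a′ , r) ← r
      (a′≈a , r) ← r
      ex i (ex a (i∈k & (a∈M & IsPr-resp ≈-refl i′≈i a′≈a r)))

    functional′ : [ i , a ]∈ s → [ i , b ]∈ s → a ≈ b
    functional′ ia ib = do
      (z , r) ← ia
      (z∈s , r) ← r
      (j , q) ← pairs′ z z∈s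
      (c , q) ← q
      (j∈k , q) ← q
      (_ , q) ← q
      (_ , val) ← p
      (y , u) ← val _ (≈-substˡ (IsPr-injˡ q r) j∈k)
      ≈-trans (to (u _) (∈′-from ia)) (≈-sym (to (u _) (∈′-from ib)))

  map-from : FunOn s k M → IsMap s k M
  map-from F =
    (λ p p∈s → do
      (i , q) ← pairs F p p∈s
      (a , q) ← q
      (i∈k , q) ← q
      (a∈M , q) ← q
      ex i (i∈k & ex a (a∈M & ex i (≈-refl & ex a (≈-refl & q)))))
    & λ i i∈k → do
      (a , q) ← value F i i∈k
      ex a λ z → (λ r → functional F (∈′-to r) q) & λ e → ∈′-from ([]∈-resp ≈-refl (≈-sym e) q)

  FunOn-⊆ : M ⊆ N → FunOn s k M → FunOn s k N
  FunOn-⊆ M⊆N F = record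
    { pairs = λ p p∈s → do
        (i , q) ← pairs F p p∈s
        (a , q) ← q
        (i∈k , q) ← q
        (a∈M , q) ← q
        ex i (ex a (i∈k & (M⊆N a a∈M & q)))
    ; value = value F
    ; functional = functional F }

  adj-⊆ : Adj z x y → x ⊆ z
  adj-⊆ pz w w∈x = from (pz w) (inl w∈x)

  adj-∋ : Adj z x y → y ∈ₛ z
  adj-∋ pz = from (pz _) (inr ≈-refl)

  adj-[]∈ : IsPr p x y → Adj g′ g p → [ u , v ]∈ g′ → [ u , v ]∈ g ∨ (u ≈ x ∧ v ≈ y)
  adj-[]∈ pp pg uv = do
    (z , q) ← uv
    (z∈g′ , q) ← q
    or (to (pg z) z∈g′)
      (λ z∈g → inl (ex z (z∈g & q)))
      (λ z≈p → let q′ = IsPr-resp z≈p ≈-refl ≈-refl q in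
               inr (IsPr-injˡ q′ pp & IsPr-injʳ q′ pp))

  FunOn-extend : FunOn s k M → IsS k′ k → ¬ (k ∈ₛ k) → h ∈ₛ M → IsPr p k h → Adj s′ s p →
                 FunOn s′ k′ M
  FunOn-extend {s} {k} {M} {k′} {h} {p} {s′} F k′S k∉k h∈M pp ps = record
    { pairs = λ z z∈s′ → or (to (ps z) z∈s′)
        (λ z∈s → do
          (i , q) ← pairs F z z∈s
          (a , q) ← q
          (i∈k , q) ← q
          ex i (ex a (adj-⊆ k′S i i∈k & q)))
        (λ z≈p → ex k (ex h (adj-∋ k′S & (h∈M & IsPr-resp (≈-sym z≈p) ≈-refl ≈-refl pp))))
    ; value = λ i i∈k′ → or (to (k′S i) i∈k′)
        (λ i∈k → do
          (a , q) ← value F i i∈k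
          ex a ([]∈-mono (adj-⊆ ps) q))
        (λ i≈k → ex h (ex p (adj-∋ ps & IsPr-resp ≈-refl (≈-sym i≈k) ≈-refl pp)))
    ; functional = λ ia ib → or (adj-[]∈ pp ps ia)
        (λ ia → or (adj-[]∈ pp ps ib)
          (functional F ia)
          (λ e → exfalso (k∉k (≈-substˡ (fst e) (dom F ia)))))
        (λ e → or (adj-[]∈ pp ps ib)
          (λ ib → exfalso (k∉k (≈-substˡ (fst e) (dom F ib))))
          (λ e′ → ≈-trans (snd e) (≈-sym (snd e′))))
    }

  FunOn-∅ : Empty s → Empty k → FunOn s k M
  FunOn-∅ s∅ k∅ = record
    { pairs = λ p p∈s → exfalso (s∅ p p∈s)
    ; value = λ i i∈k → exfalso (k∅ i i∈k)
    ; functional = λ ia → exfalso (ia λ z q → q λ r _ → s∅ z r) }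

  -- IsPair is not Δ₀ as written; for an ordered pair p, this is a Δ₀ way to
  -- say that its first component is i.
  First : Dom → Dom → Set
  First p i = EX λ q → q ∈ₛ p ∧ ∀ z → z ∈ₛ q → z ≈ i

  first-to : IsPr p x y → First p i → x ≈ i
  first-to pp fp = do
    (a , r) ← pp
    (pa , r) ← r
    (b , r) ← r
    (pb , r) ← r
    (q , t) ← fp
    (q∈p , all) ← t
    or (to (r q) q∈p)
      (λ q≈a → all _ (≈-substʳ (≈-sym q≈a) (from (pa _) (inl ≈-refl))))
      (λ q≈b → all _ (≈-substʳ (≈-sym q≈b) (from (pb _) (inl ≈-refl))))

  first-from : IsPr p x y → x ≈ i → First p i
  first-from pp x≈i = do
    (a , r) ← pp
    (pa , r) ← r
    (b , r) ← r
    (pb , r) ← r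
    ex a (from (r a) (inl ≈-refl) & λ z z∈a → ≈-trans (or (to (pa z) z∈a) id id) x≈i)

  remove : ∀ s i → EX λ t → ∀ p → p ∈ₛ t ⇔ (p ∈ₛ s ∧ ¬ First p i)
  remove s i = ⊨BST (Δ₀-sep {n = 1} {φ = ¬' (∃∈ v0 (∀∈ v0 (v0 ≐ v3)))}
                      (⇒ˡ (∃∈ˡ (∀∈ˡ ≐ˡ)) ⊥ˡ)) i s

  record Updated (s k M i d s′ : Dom) : Set where
    field
      function : FunOn s′ k M
      at       : [ i , d ]∈ s′
      off-to   : ∀ {j a} → ¬ (j ≈ i) → [ j , a ]∈ s → [ j , a ]∈ s′
      off-from : ∀ {j a} → ¬ (j ≈ i) → [ j , a ]∈ s′ → [ j , a ]∈ s

  -- The pairs with first component `i` are removed and the pair of `i` and `d` is adjoined.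
  -- Tarski's clause for the quantifier needs such a set for each `d` in `M`.
  update : FunOn s k M → i ∈ₛ k → d ∈ₛ M → EX λ s′ → Updated s k M i d s′
  update {s} {k} {M} {i} {d} F i∈k d∈M = do
    (t , pt) ← remove s i
    (p , pp) ← pair-ex i d
    (s′ , ps) ← adj-ex t p
    let kept : ∀ {j a} → ¬ (j ≈ i) → [ j , a ]∈ s → [ j , a ]∈ t
        kept j≉i ja = do
          (z , q) ← ja
          (z∈s , q) ← q
          ex z (from (pt z) (z∈s & (λ fz → j≉i (first-to q fz))) & q)
        in-t : ∀ {j a} → [ j , a ]∈ t → [ j , a ]∈ s ∧ ¬ (j ≈ i)
        in-t ja = do
          (z , q) ← ja
          (z∈t , q) ← q
          (z∈s , nf) ← to (pt z) z∈t
          ex z (z∈s & q) & λ j≈i → nf (first-from q j≈i)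
    ex s′ record
      { function = record
        { pairs = λ z z∈s′ → or (to (ps z) z∈s′)
            (λ z∈t → pairs F z (fst (to (pt z) z∈t)))
            (λ z≈p → ex i (ex d (i∈k & (d∈M & IsPr-resp (≈-sym z≈p) ≈-refl ≈-refl pp))))
        ; value = λ j j∈k → em
            (λ (j≈i : j ≈ i) → ex d (ex p (adj-∋ ps & IsPr-resp ≈-refl (≈-sym j≈i) ≈-refl pp)))
            (λ j≉i → do
              (a , ja) ← value F j j∈k
              ex a ([]∈-mono (adj-⊆ ps) (kept j≉i ja)))
        ; functional = λ ja jb → or (adj-[]∈ pp ps ja)
            (λ ja → or (adj-[]∈ pp ps jb)
              (λ jb → functional F (fst (in-t ja)) (fst (in-t jb)))
              (λ e → exfalso (snd (in-t ja) (fst e))))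
            (λ e → or (adj-[]∈ pp ps jb)
              (λ jb → exfalso (snd (in-t jb) (fst e)))
              (λ e′ → ≈-trans (snd e) (≈-sym (snd e′))))
        }
      ; at = ex p (adj-∋ ps & pp)
      ; off-to = λ j≉i ja → []∈-mono (adj-⊆ ps) (kept j≉i ja)
      ; off-from = λ j≉i ja → or (adj-[]∈ pp ps ja)
          (λ ja → fst (in-t ja))
          (λ e → exfalso (j≉i (fst e)))
      }

  -- Natural numbers and numerals

  IsNatural : Dom → Set
  IsNatural x = ⟦ Natural v0 ⟧ (∅ᵉ ▸ x)

  natural-∅ : Empty x → IsNatural x
  natural-∅ x∅ = do
    (w , iw) ← ⊨BST omega
    (ind , min) ← iw
    (z , _) ← ind
    (e , q) ← z
    (e∈w , e∅) ← q
    ex w (iw & ≈-substˡ (Is-uniq {e = ∅ᵉ} ∅ e∅ x∅) e∈w)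

  natural-suc : IsNatural x → IsS y x → IsNatural y
  natural-suc nx y=x+1 = do
    (w , q) ← nx
    (iw , x∈w) ← q
    (ind , min) ← iw
    (_ , succ) ← ind
    (z , q) ← succ _ x∈w
    (z∈w , z=x+1) ← q
    ex w (iw & ≈-substˡ (Adj-uniq z=x+1 y=x+1) z∈w)

  -- BST has no Foundation, so irreflexivity is carried along the successor steps by which numerals
  -- and lengths of sequences arise; transitivity is what preserves it.
  record Ordinal (n : Dom) : Set where
    field
      natural     : IsNatural n
      transitive  : ∀ x → x ∈ₛ n → x ⊆ n
      irreflexive : ¬ (n ∈ₛ n)
  open Ordinal public

  ordinal-∅ : Empty x → Ordinal x
  ordinal-∅ x∅ = record
    { natural = natural-∅ x∅
    ; transitive = λ y y∈x → exfalso (x∅ y y∈x)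
    ; irreflexive = λ x∈x → x∅ _ x∈x }

  ordinal-suc : Ordinal x → IsS y x → Ordinal y
  ordinal-suc {x} {y} o yS = record
    { natural = natural-suc (natural o) yS
    ; transitive = λ z z∈y w w∈z → or (to (yS z) z∈y)
        (λ z∈x → adj-⊆ yS w (transitive o z z∈x w w∈z))
        (λ z≈x → adj-⊆ yS w (≈-substʳ z≈x w∈z))
    ; irreflexive = λ y∈y → or (to (yS y) y∈y)
        (λ y∈x → irreflexive o (transitive o y y∈x x (adj-∋ yS)))
        (λ y≈x → irreflexive o (≈-substʳ y≈x (adj-∋ yS))) }

  Num : ℕ → Dom → Set
  Num K x = Is ∅ᵉ x (num K)

  instance
    Stable-Ordinal : Stable (Ordinal x)
    Stable-Ordinal = stable λ n → record
      { natural     = stab λ k → n λ o → k (natural o)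
      ; transitive  = stab λ k → n λ o → k (transitive o)
      ; irreflexive = stab λ k → n λ o → k (irreflexive o) }

  num-ordinal : ∀ K → Num K x → Ordinal x
  num-ordinal zero    p = ordinal-∅ p
  num-ordinal (suc K) p = do
    (a , q) ← p
    (pa , xS) ← q
    ordinal-suc (num-ordinal K pa) xS

  num-∈ : ∀ {x y i K} → i < K → Num i x → Num K y → x ∈ₛ y
  num-∈ {x} {y} {i} {suc K} (s≤s i≤K) px py = do
    (a , q) ← py
    (pa , yS) ← q
    case′ (m≤n⇒m<n∨m≡n i≤K) pa yS
    where
    case′ : i < K ⊎ i ≡ K → Num K a → IsS y a → x ∈ₛ y
    case′ (inj₁ i<K)  pa yS = adj-⊆ yS _ (num-∈ i<K px pa)
    case′ (inj₂ refl) pa yS = ≈-substˡ (Is-uniq (num K) pa px) (adj-∋ yS)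

  num-≉ : ∀ {i K} → i < K → Num i x → Num K y → ¬ (x ≈ y)
  num-≉ {K = K} i<K px py x≈y =
    irreflexive (num-ordinal K py) (≈-substˡ x≈y (num-∈ i<K px py))

-- Levels of variables and width of formulas

level : Fin n → ℕ
level {n} i = n ∸ suc (toℕ i)

level< : (i : Fin n) → level i < n
level< {suc n} i = s≤s (m∸n≤m n (toℕ i))

-- The name that `⌜_⌝` gives to a variable. In a scope enlarged by a quantifier, the level of
-- `suc i` computes to that of `i`, and the new variable has level `n`.
var : Fin n → Tm m
var i = num (level i)

-- The number of levels used by a formula, counting those of its free variables.
width : Formula n → ℕ
width {n} (x ε y) = n
width {n} (x ≐ y) = n
width {n} ⊥'      = n
width (φ ⇒ ψ)     = width φ ⊔ width ψ
width (∀' φ)      = width φ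

≤-width : (φ : Formula n) → n ≤ width φ
≤-width (x ε y) = ≤-refl
≤-width (x ≐ y) = ≤-refl
≤-width ⊥'      = ≤-refl
≤-width (φ ⇒ ψ) = ≤-trans (≤-width φ) (m≤m⊔n _ _)
≤-width (∀' φ)  = ≤-trans (n≤1+n _) (≤-width φ)

module Satisfaction (𝓜 : Structure)
  (⊨BST : ∀ {τ} → BST τ → Structure.⊨_ 𝓜 τ) where

  open Functions 𝓜 ⊨BST public

  private variable
    a b D f g g′ h i j k M p q s S x y z ν : Dom

  two : Dom → Dom → Fin 2 → Dom
  two x y = ∅ᵉ ▸ x ▸ y

  module _ {x y : Dom} (t u : Tm 0) (px : Is ∅ᵉ x t) (py : Is ∅ᵉ y u) where

    private
      θ : Fin 2 → Tm 0
      θ = ∅ᵉ ▸ t ▸ u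

      vals : ∀ i → Is ∅ᵉ (two x y i) (θ i)
      vals zero       = py
      vals (suc zero) = px

    -- Formation rules and Tarski's clauses apply a code constructor to variables, whereas a code is
    -- a closed term; `x` and `y` are the values of its two parts.
    two-to : ∀ r → Is ∅ᵉ z (sub θ r) → Is (two x y) z r
    two-to r = sub-to vals r

    coded-to : ∀ r → Is ∅ᵉ f (sub θ r) → PairIn (λ z → Is (two x y) z r) (_≈ s) S → [ f , s ]∈ S
    coded-to r f= = pairIn-to (λ p → Is-uniq (sub θ r) (sub-from vals r p) f=) id

    coded-from : ∀ r → Is ∅ᵉ f (sub θ r) → [ f , s ]∈ S → PairIn (λ z → Is (two x y) z r) (_≈ s) S
    coded-from r f= = pairIn-from {P = λ z → Is (two x y) z r} (two-to r f=) ≈-refl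

  Code : Formula n → Dom → Set
  Code φ f = Is ∅ᵉ f ⌜ φ ⌝

  -- Formation sequences

  FS : (k g m h : Dom) → Set
  FS k g m h = ⟦ FormStep v0 v1 v2 v3 ⟧ (∅ᵉ ▸ h ▸ m ▸ g ▸ k)

  -- A disjunction is a function of refutations of its earlier disjuncts, and the last disjunct here
  -- is itself a negation. Each rule contradicts the argument that belongs to its own disjunct.
  fs-mem : i ∈ₛ k → j ∈ₛ k → Is (two i j) h (memᶜ (` v1) (` v0)) → FS k g ν h
  fs-mem i∈k j∈k p n₁ _ _ _ _ = n₁ (ex _ (i∈k & ex _ (j∈k & p)))

  fs-eq : i ∈ₛ k → j ∈ₛ k → Is (two i j) h (eqᶜ (` v1) (` v0)) → FS k g ν h
  fs-eq i∈k j∈k p _ n₂ _ _ _ = n₂ (ex _ (i∈k & ex _ (j∈k & p)))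

  fs-⊥ : Is ∅ᵉ h ⊥ᶜ → FS k g ν h
  fs-⊥ p _ _ n₃ _ _ = n₃ p

  fs-imp : p ∈ₛ ν → q ∈ₛ ν → [ p , a ]∈ g → [ q , b ]∈ g →
           Is (two a b) h (impᶜ (` v1) (` v0)) → FS k g ν h
  fs-imp p∈ν q∈ν pa qb r _ _ _ n₄ _ =
    n₄ (ex _ (p∈ν & ex _ (q∈ν & ex _ (ex _ (∈′-from pa & (∈′-from qb & r))))))

  fs-all : i ∈ₛ k → p ∈ₛ ν → [ p , a ]∈ g →
           Is (two i a) h (allᶜ (` v1) (` v0)) → FS k g ν h
  fs-all i∈k p∈ν pa r _ _ _ _ = λ n₅ → n₅ _ (i∈k & ex _ (p∈ν & ex _ (∈′-from pa & r)))

  fs-mono : g ⊆ g′ → FS k g ν h → FS k g′ ν h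
  fs-mono g⊆g′ fs n₁ n₂ n₃ n₄ = λ n₅ →
    fs n₁ n₂ n₃
      (λ t → t λ p t → t λ p∈ν t → t λ q t → t λ q∈ν t → t λ a t → t λ b t →
        t λ pa t → t λ qb r →
          n₄ (ex p (p∈ν & ex q (q∈ν & ex a (ex b (mono pa & (mono qb & r)))))))
      λ i t → t λ i∈k t → t λ p t → t λ p∈ν t → t λ a t → t λ pa r →
        n₅ i (i∈k & ex p (p∈ν & ex a (mono pa & r)))
    where
    mono : [ x , y ]∈′ _ → [ x , y ]∈′ _
    mono p = ∈′-from ([]∈-mono g⊆g′ (∈′-to p))

  record Sequence (k ν D g : Dom) : Set where
    field
      ordinal  : Ordinal ν
      function : FunOn g ν D
      formed   : ∀ m → m ∈ₛ ν → ∀ h → [ m , h ]∈ g → FS k g m h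
  open Sequence

  sequence-∅ : Empty ν → Empty g → Sequence k ν D g
  sequence-∅ ν∅ g∅ = record
    { ordinal = ordinal-∅ ν∅
    ; function = FunOn-∅ g∅ ν∅
    ; formed = λ m m∈ν → exfalso (ν∅ m m∈ν) }

  record Appended (k ν g h ν′ D′ g′ : Dom) : Set where
    field
      length   : IsS ν′ ν
      sequence : Sequence k ν′ D′ g′
      extends  : g ⊆ g′
      last     : [ ν , h ]∈ g′

  append : Sequence k ν D g → FS k g ν h →
           EX λ ν′ → EX λ D′ → EX λ g′ → Appended k ν g h ν′ D′ g′
  append {k} {ν} {D} {g} {h} sq fs = do
    (ν′ , ν′S) ← adj-ex ν ν
    (D′ , pD) ← adj-ex D h
    (p , pp) ← pair-ex ν h
    (g′ , pg) ← adj-ex g p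
    ex ν′ (ex D′ (ex g′ record
      { length = ν′S
      ; sequence = record
        { ordinal = ordinal-suc (ordinal sq) ν′S
        ; function = FunOn-extend (FunOn-⊆ (adj-⊆ pD) (function sq)) ν′S
                       (irreflexive (ordinal sq)) (adj-∋ pD) pp pg
        ; formed = λ m m∈ν′ h′ mh → fs-mono (adj-⊆ pg) (or (adj-[]∈ pp pg mh)
            (λ mh → formed sq m (dom (function sq) mh) h′ mh)
            (λ e → resp (FormStep v0 v1 v2 v3) {∅ᵉ ▸ h ▸ ν ▸ g ▸ k} {∅ᵉ ▸ h′ ▸ m ▸ g ▸ k}
              ((λ ()) ▸≈ ≈-sym (snd e) ▸≈ ≈-sym (fst e) ▸≈ ≈-refl ▸≈ ≈-refl) fs))
        }
      ; extends = adj-⊆ pg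
      ; last = ex p (adj-∋ pg & pp) }))

  -- `f` is ready to be entered but not yet entered: appending it puts it at position `ν′`, so its
  -- position is known.
  record Prepared (k ν g f ν′ D′ g′ : Dom) : Set where
    field
      sequence : Sequence k ν′ D′ g′
      extends  : g ⊆ g′
      longer   : ν ⊆ ν′
      next     : FS k g′ ν′ f

  IsForm : Dom → Dom → Set
  IsForm k f = ⟦ Form v0 v1 ⟧ (∅ᵉ ▸ f ▸ k)

  module Codes (K : ℕ) {k : Dom} (k=K : Num K k) where

    num∈k : ∀ {l} → l < K → Num l x → x ∈ₛ k
    num∈k l<K x=l = num-∈ l<K x=l k=K

    var∈k : (i : Fin n) → n ≤ K → Is ∅ᵉ x (var i) → x ∈ₛ k
    var∈k i n≤K = num∈k (<-≤-trans (level< i) n≤K)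

    -- A given sequence is extended instead of concatenating the sequences of
    -- the subformulas, so that no positions have to be shifted.
    prepare : (φ : Formula n) → width φ ≤ K → Code φ f → Sequence k ν D g →
              EX λ ν′ → EX λ D′ → EX λ g′ → Prepared k ν g f ν′ D′ g′
    prepare-now : Sequence k ν D g → FS k g ν f →
                  EX λ ν′ → EX λ D′ → EX λ g′ → Prepared k ν g f ν′ D′ g′
    prepare-now sq fs = ex _ (ex _ (ex _ record
      { sequence = sq ; extends = λ _ → id ; longer = λ _ → id ; next = fs }))

    prepare (x ε y) n≤K f= sq = do
      (i , i=) ← Is-ex (var x)
      (j , j=) ← Is-ex (var y)
      prepare-now sq (fs-mem
        (var∈k x n≤K i=) (var∈k y n≤K j=)
        (two-to (var x) (var y) i= j= (memᶜ (` v1) (` v0)) f=))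
    prepare (x ≐ y) n≤K f= sq = do
      (i , i=) ← Is-ex (var x)
      (j , j=) ← Is-ex (var y)
      prepare-now sq (fs-eq
        (var∈k x n≤K i=) (var∈k y n≤K j=)
        (two-to (var x) (var y) i= j= (eqᶜ (` v1) (` v0)) f=))
    prepare ⊥' n≤K f= sq = prepare-now sq (fs-⊥ f=)
    prepare (φ ⇒ ψ) w≤K f= sq₀ = do
      (a , a=) ← Is-ex ⌜ φ ⌝
      (b , b=) ← Is-ex ⌜ ψ ⌝
      (ν₁ , r) ← prepare φ (m⊔n≤o⇒m≤o (width φ) _ w≤K) a= sq₀
      (_ , r) ← r
      (g₁ , p₁) ← r
      (ν₂ , r) ← append (sequence p₁) (next p₁)
      (_ , r) ← r
      (g₂ , p₂) ← r
      (ν₃ , r) ← prepare ψ (m⊔n≤o⇒n≤o (width φ) _ w≤K) b= (Appended.sequence p₂)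
      (_ , r) ← r
      (g₃ , p₃) ← r
      (ν₄ , r) ← append (sequence p₃) (next p₃)
      (D₄ , r) ← r
      (g₄ , p₄) ← r
      -- The code of `φ` stands at position `ν₁` and that of `ψ` at `ν₃`; both positions lie in
      -- `ν₄`, and later extensions keep earlier entries.
      let g₂⊆g₄ = λ z → Appended.extends p₄ z ∘ extends p₃ z
          ν₂⊆ν₄ = λ z → adj-⊆ (Appended.length p₄) z ∘ longer p₃ z
          ν₁∈ν₂ = adj-∋ (Appended.length p₂)
      ex ν₄ (ex D₄ (ex g₄ record
        { sequence = Appended.sequence p₄
        ; extends = λ z → g₂⊆g₄ z ∘ Appended.extends p₂ z ∘ extends p₁ z
        ; longer = λ z → ν₂⊆ν₄ z ∘ adj-⊆ (Appended.length p₂) z ∘ longer p₁ z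
        ; next = fs-imp (ν₂⊆ν₄ _ ν₁∈ν₂) (adj-∋ (Appended.length p₄))
                   ([]∈-mono g₂⊆g₄ (Appended.last p₂)) (Appended.last p₄)
                   (two-to ⌜ φ ⌝ ⌜ ψ ⌝ a= b= (impᶜ (` v1) (` v0)) f=) }))
      where open Prepared
    prepare {n} (∀' φ) w≤K f= sq₀ = do
      (i , i=) ← Is-ex (num n)
      (a , a=) ← Is-ex ⌜ φ ⌝
      (ν₁ , r) ← prepare φ w≤K a= sq₀
      (_ , r) ← r
      (g₁ , p₁) ← r
      (ν₂ , r) ← append (sequence p₁) (next p₁)
      (D₂ , r) ← r
      (g₂ , p₂) ← r
      ex ν₂ (ex D₂ (ex g₂ record
        { sequence = Appended.sequence p₂
        ; extends = λ z → Appended.extends p₂ z ∘ extends p₁ z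
        ; longer = λ z → adj-⊆ (Appended.length p₂) z ∘ longer p₁ z
        ; next = fs-all (num∈k (≤-trans (≤-width φ) w≤K) i=)
                   (adj-∋ (Appended.length p₂)) (Appended.last p₂)
                   (two-to (num n) ⌜ φ ⌝ i= a= (allᶜ (` v1) (` v0)) f=) }))
      where open Prepared

    -- Tarski's clauses for implication and quantifier speak only about codes with `Form`, so a
    -- formation sequence must be exhibited, starting from the empty one.
    form : (φ : Formula n) → width φ ≤ K → Code φ f → IsForm k f
    form φ w≤K f= = natural (num-ordinal K k=K) & do
      (z , z∅) ← Is-ex {e = ∅ᵉ} ∅
      (ν₁ , r) ← prepare φ w≤K f= (sequence-∅ {D = z} z∅ z∅)
      (_ , r) ← r
      (g₁ , p₁) ← r
      (ν₂ , r) ← append (Prepared.sequence p₁) (Prepared.next p₁)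
      (D₂ , r) ← r
      (g₂ , p₂) ← r
      let sq₂ = Appended.sequence p₂
      ex ν₁ (ex ν₂ (ex D₂ (ex g₂
        ( natural (ordinal (Prepared.sequence p₁))
        & ( ex ν₁ (≈-refl & Appended.length p₂)
        & ( map-from (function sq₂)
        & ( ∈′-from (Appended.last p₂)
        & λ m m∈ν₂ h mh → formed sq₂ m m∈ν₂ h (∈′-to mh))))))))

  -- Satisfaction

  Rel : Dom → Formula n → (Fin n → Dom) → Set
  Rel M (x ε y) ρ = ρ x ∈ₛ ρ y
  Rel M (x ≐ y) ρ = ρ x ≈ ρ y
  Rel M ⊥'      ρ = ⊥
  Rel M (φ ⇒ ψ) ρ = Rel M φ ρ → Rel M ψ ρ
  Rel M (∀' φ)  ρ = ∀ d → d ∈ₛ M → Rel M φ (ρ ▸ d)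

  Stable-Rel : (φ : Formula n) {ρ : Fin n → Dom} → Stable (Rel M φ ρ)
  Stable-Rel (x ε y) = Stable-∈
  Stable-Rel (x ≐ y) = Stable-≈
  Stable-Rel ⊥'      = Stable-⊥
  Stable-Rel (φ ⇒ ψ) = Stable-Π {{Stable-Rel ψ}}
  Stable-Rel (∀' φ)  = Stable-Π {{Stable-Π {{Stable-Rel φ}}}}

  IsSatisfaction : Dom → Dom → Set
  IsSatisfaction M S = ⟦ IsSat v0 v1 ⟧ (∅ᵉ ▸ S ▸ M)

  Assigns : Dom → (Fin n → Dom) → Set
  Assigns s ρ = ∀ i {x} → Is ∅ᵉ x (var i) → [ x , ρ i ]∈ s

  module Truth (K : ℕ) {k : Dom} (k=K : Num K k) {M S : Dom} (sat : IsSatisfaction M S) where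

    open Codes K k=K

    clauses : FunOn s k M → ⟦ TarskiClauses v0 v1 v2 v3 ⟧ (∅ᵉ ▸ s ▸ k ▸ S ▸ M)
    clauses F = sat _ _ (natural (num-ordinal K k=K) & map-from F)

    -- Induction on `φ` by Tarski's clauses. All assignments have the same domain `k`, which covers
    -- the levels of bound variables too; a quantifier changes the value at its level.
    truth-to   : (φ : Formula n) {ρ : Fin n → Dom} → width φ ≤ K → Code φ f → FunOn s k M →
                 Assigns s ρ → [ f , s ]∈ S → Rel M φ ρ
    truth-from : (φ : Formula n) {ρ : Fin n → Dom} → width φ ≤ K → Code φ f → FunOn s k M →
                 Assigns s ρ → Rel M φ ρ → [ f , s ]∈ S

    truth-to (x ε y) n≤K f= F as fs∈S = do
      (i , i=) ← Is-ex (var x)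
      (j , j=) ← Is-ex (var y)
      (c , _) ← clauses F
      (a , r) ← to (c i (var∈k x n≤K i=) j (var∈k y n≤K j=))
        (coded-from (var x) (var y) i= j= (memᶜ (` v1) (` v0)) f= fs∈S)
      (b , r) ← r
      (ia , r) ← r
      (jb , a∈b) ← r
      ≈-substˡ (functional F (∈′-to ia) (as x i=))
        (≈-substʳ (functional F (∈′-to jb) (as y j=)) a∈b)
    truth-to (x ≐ y) n≤K f= F as fs∈S = do
      (i , i=) ← Is-ex (var x)
      (j , j=) ← Is-ex (var y)
      (_ , r) ← clauses F
      (c , _) ← r
      (a , r) ← to (c i (var∈k x n≤K i=) j (var∈k y n≤K j=))
        (coded-from (var x) (var y) i= j= (eqᶜ (` v1) (` v0)) f= fs∈S)
      (b , r) ← r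
      (ia , r) ← r
      (jb , a≈b) ← r
      ≈-trans (functional F (as x i=) (∈′-to ia)) (≈-trans a≈b (functional F (∈′-to jb) (as y j=)))
    truth-to ⊥' n≤K f= F as fs∈S = do
      (_ , r) ← clauses F
      (_ , r) ← r
      (c , _) ← r
      c (pairIn-from {P = λ z → Is ∅ᵉ z ⊥ᶜ} f= ≈-refl fs∈S)
    truth-to (φ ⇒ ψ) w≤K f= F as fs∈S r₀ = let instance st = Stable-Rel ψ in do
      (a , a=) ← Is-ex ⌜ φ ⌝
      (b , b=) ← Is-ex ⌜ ψ ⌝
      (_ , r) ← clauses F
      (_ , r) ← r
      (_ , r) ← r
      (c , _) ← r
      let wφ = m⊔n≤o⇒m≤o (width φ) _ w≤K
          wψ = m⊔n≤o⇒n≤o (width φ) _ w≤K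
      truth-to ψ wψ b= F as (∈′-to (to (c a b (form φ wφ a= & form ψ wψ b=))
        (coded-from ⌜ φ ⌝ ⌜ ψ ⌝ a= b= (impᶜ (` v1) (` v0)) f= fs∈S)
        (∈′-from (truth-from φ wφ a= F as r₀))))
    truth-to {n} (∀' φ) {ρ} w≤K f= F as fs∈S d d∈M = let instance st = Stable-Rel φ in do
      (i , i=) ← Is-ex (num n)
      (a , a=) ← Is-ex ⌜ φ ⌝
      (_ , r) ← clauses F
      (_ , r) ← r
      (_ , r) ← r
      (_ , c) ← r
      let i∈k = num∈k (≤-trans (≤-width φ) w≤K) i=
      (s′ , up) ← update F i∈k d∈M
      let open Updated up
          as′ : Assigns s′ (ρ ▸ d)
          -- The outer variables have levels below `n`, so the update at `n` leaves their values
          -- unchanged.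
          as′ = λ { zero    x= → []∈-resp (Is-uniq (num n) i= x=) ≈-refl at
                  ; (suc j) x= → off-to (num-≉ (level< j) x= i=) (as j x=) }
      truth-to φ w≤K a= (Updated.function up) as′ (∈′-to (to (c i i∈k a (form φ w≤K a=))
        (coded-from (num n) ⌜ φ ⌝ i= a= (allᶜ (` v1) (` v0)) f= fs∈S)
        s′ (map-from (Updated.function up) & λ j j∈k j≉i b →
          (λ p → ∈′-from (off-to j≉i (∈′-to p))) & λ p → ∈′-from (off-from j≉i (∈′-to p)))))

    truth-from (x ε y) n≤K f= F as ρx∈ρy = do
      (i , i=) ← Is-ex (var x)
      (j , j=) ← Is-ex (var y)
      (c , _) ← clauses F
      coded-to (var x) (var y) i= j= (memᶜ (` v1) (` v0)) f=
        (from (c i (var∈k x n≤K i=) j (var∈k y n≤K j=))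
          (ex _ (ex _ (∈′-from (as x i=) & (∈′-from (as y j=) & ρx∈ρy)))))
    truth-from (x ≐ y) n≤K f= F as ρx≈ρy = do
      (i , i=) ← Is-ex (var x)
      (j , j=) ← Is-ex (var y)
      (_ , r) ← clauses F
      (c , _) ← r
      coded-to (var x) (var y) i= j= (eqᶜ (` v1) (` v0)) f=
        (from (c i (var∈k x n≤K i=) j (var∈k y n≤K j=))
          (ex _ (ex _ (∈′-from (as x i=) & (∈′-from (as y j=) & ρx≈ρy)))))
    truth-from ⊥' n≤K f= F as x = exfalso x
    truth-from (φ ⇒ ψ) w≤K f= F as r₀ = do
      (a , a=) ← Is-ex ⌜ φ ⌝
      (b , b=) ← Is-ex ⌜ ψ ⌝
      (_ , r) ← clauses F
      (_ , r) ← r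
      (_ , r) ← r
      (c , _) ← r
      let wφ = m⊔n≤o⇒m≤o (width φ) _ w≤K
          wψ = m⊔n≤o⇒n≤o (width φ) _ w≤K
      coded-to ⌜ φ ⌝ ⌜ ψ ⌝ a= b= (impᶜ (` v1) (` v0)) f=
        (from (c a b (form φ wφ a= & form ψ wψ b=))
          (λ as∈S → ∈′-from (truth-from ψ wψ b= F as (r₀ (truth-to φ wφ a= F as (∈′-to as∈S))))))
    truth-from {n} (∀' φ) {ρ} w≤K f= F as r₀ = do
      (i , i=) ← Is-ex (num n)
      (a , a=) ← Is-ex ⌜ φ ⌝
      (_ , r) ← clauses F
      (_ , r) ← r
      (_ , r) ← r
      (_ , c) ← r
      let i∈k = num∈k (≤-trans (≤-width φ) w≤K) i=
      coded-to (num n) ⌜ φ ⌝ i= a= (allᶜ (` v1) (` v0)) f=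
        (from (c i i∈k a (form φ w≤K a=)) λ s′ r → do
          (mp , agree) ← r
          -- Conversely, any `s′` that agrees with `s` off level `n` assigns `ρ ▸ d`, where `d` is
          -- its value there.
          let F′ = map-to mp
          (d , id∈s′) ← value F′ i i∈k
          let as′ : Assigns s′ (ρ ▸ d)
              as′ = λ { zero    x= → []∈-resp (Is-uniq (num n) i= x=) ≈-refl id∈s′
                      ; (suc j) x= → ∈′-to (to
                          (agree _ (dom F (as j x=)) (num-≉ (level< j) x= i=) _)
                          (∈′-from (as j x=))) }
          ∈′-from (truth-from φ w≤K a= F′ as′ (r₀ d (cod F′ id∈s′))))

-- Strongly extendible models

module StrongExtension (𝓜 : Structure)
  (⊨T : ∀ {τ} → LZFCˢᵉˣᵗ τ → Structure.⊨_ 𝓜 τ) where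

  open Satisfaction 𝓜 (λ t → ⊨T (bst t))

  private variable
    f k M N p s S x y : Dom

  -- Variable `zero` has the highest level, so `ρ` is entered from its outermost variable inwards.
  -- The levels from `n` up to `K` belong to bound variables and receive the default value `x`.
  assign : ∀ {n K} {ρ : Fin n → Dom} → n ≤′ K → Num K k → x ∈ₛ M → (∀ i → ρ i ∈ₛ M) →
           EX λ s → FunOn s k M × Assigns s ρ
  assign {n = zero} ≤′-refl k∅ _ _ = do
    (s , s∅) ← Is-ex {e = ∅ᵉ} ∅
    ex s (FunOn-∅ s∅ k∅ , λ ())
  assign {n = suc n} {ρ = ρ} ≤′-refl k= x∈M ρ∈M = do
    (j , q) ← k=
    (j= , kS) ← q
    (s , r) ← assign {ρ = ρ ∘ suc} ≤′-refl j= x∈M (ρ∈M ∘ suc)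
    (p , pp) ← pair-ex j (ρ zero)
    (s′ , ps) ← adj-ex s p
    ex s′
      ( FunOn-extend (proj₁ r) kS (irreflexive (num-ordinal n j=)) (ρ∈M zero) pp ps
      , λ { zero    y= → []∈-resp (Is-uniq (num n) j= y=) ≈-refl (ex p (adj-∋ ps & pp))
          ; (suc i) y= → []∈-mono (adj-⊆ ps) (proj₂ r i y=) })
  assign {x = x} {K = suc K} (≤′-step n≤K) k= x∈M ρ∈M = do
    (j , q) ← k=
    (j= , kS) ← q
    (s , r) ← assign n≤K j= x∈M ρ∈M
    (p , pp) ← pair-ex j x
    (s′ , ps) ← adj-ex s p
    ex s′
      ( FunOn-extend (proj₁ r) kS (irreflexive (num-ordinal K j=)) x∈M pp ps
      , λ i {_} y= → []∈-mono (adj-⊆ ps) (proj₂ r i y=))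

  IsModel : Dom → Set
  IsModel M = ⟦ Model v0 ⟧ (∅ᵉ ▸ M)

  IsZFC : Dom → Dom → Set
  IsZFC M f = ⟦ IsZFCAxiom v0 ⟧ (∅ᵉ ▸ M ▸ f)

  Satisfies : Dom → Dom → Dom → Set
  Satisfies M f s = ⟦ Sat v0 v1 v2 ⟧ (∅ᵉ ▸ s ▸ f ▸ M)

  Trans : Dom → Set
  Trans M = ∀ x → x ∈ₛ M → x ⊆ M

  model-point : IsModel M → EX λ x → x ∈ₛ M
  model-point mM n = mM λ pt _ → pt n

  model-trans : IsModel M → Trans M
  model-trans mM x x∈M z z∈x = ∈-stable λ n → mM λ _ r → r λ tM _ → n (tM x x∈M z z∈x)

  model-valid : IsModel M → IsZFC M f → IsForm k f → IsMap s k M → Satisfies M f s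
  model-valid {M} {f} {k} {s} mM ax fm mp n = mM λ _ r → r λ _ valid → valid f ax k s (fm & mp) n

  -- The internal objects by which satisfaction in `M` speaks about `φ` at `ρ`. They can be kept
  -- when `M` is enlarged, as the comparison of two models requires.
  record Setting (φ : Formula n) (M : Dom) (ρ : Fin n → Dom) (k f s : Dom) : Set where
    field
      k=       : Num (width φ) k
      f=       : Code φ f
      function : FunOn s k M
      assigns  : Assigns s ρ

    isForm : IsForm k f
    isForm = Codes.form (width φ) k= φ ≤-refl f=

    satisfies-to : Satisfies M f s → Rel M φ ρ
    satisfies-to sat = let instance st = Stable-Rel φ in do
      (S , r) ← sat
      (isS , fs∈S) ← r
      Truth.truth-to (width φ) k= isS φ ≤-refl f= function assigns (∈′-to fs∈S)

    -- `Sat` asserts that a satisfaction relation exists, so one has to be supplied.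
    satisfies-from : IsSatisfaction M S → Rel M φ ρ → Satisfies M f s
    satisfies-from isS r = ex _ (isS & ∈′-from
      (Truth.truth-from (width φ) k= isS φ ≤-refl f= function assigns r))

  setting : (φ : Formula n) {ρ : Fin n → Dom} → x ∈ₛ M → (∀ i → ρ i ∈ₛ M) →
            EX λ k → EX λ f → EX λ s → Setting φ M ρ k f s
  setting φ x∈M ρ∈M = do
    (k , k=) ← Is-ex (num (width φ))
    (f , f=) ← Is-ex ⌜ φ ⌝
    (s , r) ← assign (≤⇒≤′ (≤-width φ)) k= x∈M ρ∈M
    ex k (ex f (ex s record { k= = k= ; f= = f= ; function = proj₁ r ; assigns = proj₂ r }))

  model-satisfies : IsModel M → (σ : Sentence) → (∀ f → Code σ f → IsZFC M f) →
                    EX λ k → EX λ f → EX λ s → Setting σ M ∅ᵉ k f s × Satisfies M f s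
  model-satisfies mM σ ax = do
    (x , x∈M) ← model-point mM
    (k , r) ← setting σ {∅ᵉ} x∈M λ ()
    (f , r) ← r
    (s , r) ← r
    ex k (ex f (ex s (r , model-valid mM (ax f (f= r)) (isForm r) (map-from (Setting.function r)))))
    where open Setting using (f=; isForm)

  model-⊨ : IsModel M → (σ : Sentence) → (∀ f → Code σ f → IsZFC M f) → Rel M σ ∅ᵉ
  model-⊨ mM σ ax = let instance st = Stable-Rel σ in do
    (k , r) ← model-satisfies mM σ ax
    (f , r) ← r
    (s , r) ← r
    Setting.satisfies-to (proj₁ r) (proj₂ r)

  sub-num : {θ : Fin m → Tm n} → ∀ l → sub θ (num l) ≡ num l
  sub-num zero    = refl
  sub-num (suc l) = cong sucᵗ (sub-num l)

  sub-code : ∀ {l} {θ : Fin m → Tm n} (φ : Formula l) → sub θ ⌜ φ ⌝ ≡ ⌜ φ ⌝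
  sub-code (x ε y) = cong₂ memᶜ (sub-num (level x)) (sub-num (level y))
  sub-code (x ≐ y) = cong₂ eqᶜ (sub-num (level x)) (sub-num (level y))
  sub-code ⊥'      = refl
  sub-code (φ ⇒ ψ) = cong₂ impᶜ (sub-code φ) (sub-code ψ)
  sub-code {l = l} (∀' φ) = cong₂ allᶜ (sub-num l) (sub-code φ)

  code-is : (σ : Sentence) (ρ : Fin n → Dom) (x : Fin n) → Code σ (ρ x) → ⟦ x is ⌜ σ ⌝ ⟧ ρ
  code-is σ ρ x f= = isᵉ-from ⌜ σ ⌝
    (subst (Is ρ (ρ x)) (sub-code σ) (sub-from {e = ρ} {∅ᵉ} {∅ᵉ} (λ ()) ⌜ σ ⌝ f=))

  extensionality-ax : ∀ M f → Code Extensionality f → IsZFC M f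
  extensionality-ax M f f= n _ _ _ _ _ _ _ =
    λ _ → n (code-is Extensionality (∅ᵉ ▸ M ▸ f) v0 f=)

  powerset-ax : ∀ M f → Code Powerset f → IsZFC M f
  powerset-ax M f f= _ _ _ _ n _ _ _ =
    λ _ → n (code-is Powerset (∅ᵉ ▸ M ▸ f) v0 f=)

  satisfies-satisfaction : Satisfies M f s → EX λ S → IsSatisfaction M S
  satisfies-satisfaction sat n = sat λ S r → r λ isS _ → n S isS

  -- A model satisfies at least one axiom, so it has a satisfaction relation.
  model-satisfaction : IsModel M → EX λ S → IsSatisfaction M S
  model-satisfaction {M} mM n =
    model-satisfies mM Extensionality (extensionality-ax M) λ k r → r λ f r → r λ s r →
      satisfies-satisfaction {M} {f} {s} (proj₂ r) n

  IsElementary : Dom → Dom → Set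
  IsElementary M N = ⟦ Elementary v0 v1 ⟧ (∅ᵉ ▸ N ▸ M)

  elementary-⊆ : IsElementary M N → M ⊆ N
  elementary-⊆ el z z∈M = ∈-stable λ n → el λ M⊆N _ → n (M⊆N z z∈M)

  elementary-sat : IsElementary M N → IsForm k f → IsMap s k M →
                   (Satisfies M f s → Satisfies N f s) ∧ (Satisfies N f s → Satisfies M f s)
  elementary-sat {k = k} {f} {s} el fm mp n = el λ _ same → same k f s (fm & mp) n

  module _ (mM : IsModel M) (mN : IsModel N) (el : IsElementary M N)
    (φ : Formula n) {ρ : Fin n → Dom} (ρ∈M : ∀ i → ρ i ∈ₛ M) where

    private
      common : EX λ k → EX λ f → EX λ s → Setting φ M ρ k f s × Setting φ N ρ k f s
      common = do
        (x , x∈M) ← model-point mM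
        (k , r) ← setting φ x∈M ρ∈M
        (f , r) ← r
        (s , r) ← r
        let open Setting r
        ex k (ex f (ex s (r , record { k= = k= ; f= = f= ; assigns = assigns
                                     ; function = FunOn-⊆ (elementary-⊆ el) function })))

    -- Truth in `M` is coded by means of a satisfaction relation for `M`, transferred by
    -- elementarity with the same code and assignment, and decoded in `N`.
    elementary-up : Rel M φ ρ → Rel N φ ρ
    elementary-up r = stab {{Stable-Rel φ}} λ n →
      model-satisfaction mM λ _ isS → common λ k q → q λ f q → q λ s q →
      let open Setting (proj₁ q) in
      elementary-sat {M} {N} {k} {f} {s} el isForm (map-from function) λ up _ →
      n (Setting.satisfies-to (proj₂ q) (up (satisfies-from isS r)))

    elementary-down : Rel N φ ρ → Rel M φ ρ
    elementary-down r = stab {{Stable-Rel φ}} λ n →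
      model-satisfaction mN λ _ isS → common λ k q → q λ f q → q λ s q →
      let open Setting (proj₁ q) in
      elementary-sat {M} {N} {k} {f} {s} el isForm (map-from function) λ _ down →
      n (satisfies-to (down (Setting.satisfies-from (proj₂ q) isS r)))

  Extension : Dom → Dom → Set
  Extension M x = EX λ N → x ∈ₛ N × IsModel N × IsElementary M N

  locate : ∀ x → EX λ M → x ∈ₛ M × IsModel M × (∀ y → Extension M y)
  locate x n = ⊨T loc x λ M r → r λ x∈M r → r λ mM extend →
    n M (x∈M , mM , λ y n′ → extend y λ N r → r λ mN r → r λ y∈N el → n′ N (y∈N , mN , el))

  -- Transfer of Δ₀ and Σ₁ formulas between transitive sets and the universe

  ▸∈ : {ρ : Fin n → Dom} → (∀ i → ρ i ∈ₛ M) → x ∈ₛ M → ∀ i → (ρ ▸ x) i ∈ₛ M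
  ▸∈ ρ∈M x∈M zero    = x∈M
  ▸∈ ρ∈M x∈M (suc i) = ρ∈M i

  -- By transitivity, a quantifier bounded by an element of `M` ranges over elements of `M` only.
  absolute-to   : {φ : Formula n} {ρ : Fin n → Dom} → Δ₀ φ → Trans M → (∀ i → ρ i ∈ₛ M) →
                  Rel M φ ρ → ⟦ φ ⟧ ρ
  absolute-from : {φ : Formula n} {ρ : Fin n → Dom} → Δ₀ φ → Trans M → (∀ i → ρ i ∈ₛ M) →
                  ⟦ φ ⟧ ρ → Rel M φ ρ
  absolute-to εˡ tM ρ∈M r = r
  absolute-to ≐ˡ tM ρ∈M r = r
  absolute-to ⊥ˡ tM ρ∈M r = r
  absolute-to (⇒ˡ δ δ′) tM ρ∈M r q = absolute-to δ′ tM ρ∈M (r (absolute-from δ tM ρ∈M q))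
  absolute-to (∀∈ˡ {y} δ) tM ρ∈M r d d∈y =
    let d∈M = tM _ (ρ∈M y) d d∈y in absolute-to δ tM (▸∈ ρ∈M d∈M) (r d d∈M d∈y)
  absolute-to (∃∈ˡ δ) tM ρ∈M r n = r λ d d∈M q → q λ d∈y q →
    n d (d∈y & absolute-to δ tM (▸∈ ρ∈M d∈M) q)
  absolute-from εˡ tM ρ∈M r = r
  absolute-from ≐ˡ tM ρ∈M r = r
  absolute-from ⊥ˡ tM ρ∈M r = r
  absolute-from (⇒ˡ δ δ′) tM ρ∈M r q = absolute-from δ′ tM ρ∈M (r (absolute-to δ tM ρ∈M q))
  absolute-from (∀∈ˡ δ) tM ρ∈M r d d∈M d∈y = absolute-from δ tM (▸∈ ρ∈M d∈M) (r d d∈y)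
  absolute-from (∃∈ˡ {y} δ) tM ρ∈M r n = r λ d q → q λ d∈y q →
    let d∈M = tM _ (ρ∈M y) d d∈y in
    n d d∈M (d∈y & absolute-from δ tM (▸∈ ρ∈M d∈M) q)

  upward : {φ : Formula n} {ρ : Fin n → Dom} → Σ₁ φ → Trans M → (∀ i → ρ i ∈ₛ M) →
           Rel M φ ρ → ⟦ φ ⟧ ρ
  upward (bounded δ) tM ρ∈M r = absolute-to δ tM ρ∈M r
  upward (exists s)  tM ρ∈M r n = r λ d d∈M q → n d (upward s tM (▸∈ ρ∈M d∈M) q)

  transitive-upair : Trans M → UPair p x y → p ∈ₛ M → x ∈ₛ M × y ∈ₛ M
  transitive-upair tM pp p∈M = tM _ p∈M _ (from (pp _) (inl ≈-refl)) , tM _ p∈M _ (from (pp _) (inr ≈-refl))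

  -- All witnesses of a true Σ₁ statement are collected in one set w.
  downward : {φ : Formula n} {ρ : Fin n → Dom} → Σ₁ φ → ⟦ φ ⟧ ρ →
             EX λ w → ∀ M → Trans M → w ∈ₛ M → (∀ i → ρ i ∈ₛ M) → Rel M φ ρ
  downward (bounded δ) r = do
    (w , _) ← Is-ex {e = ∅ᵉ} ∅
    ex w λ M tM w∈M ρ∈M → absolute-from δ tM ρ∈M r
  downward (exists s) r = λ k → r λ d q → downward s q λ w down → upair-ex d w λ p pp →
    k p λ M tM p∈M ρ∈M n →
      let d∈M , w∈M = transitive-upair tM pp p∈M in
      n d d∈M (down M tM w∈M (▸∈ ρ∈M d∈M))

  -- `Locˢᵉˣᵗ` places one set in a model, so several parameters are packed into nested unordered
  -- pairs, which transitivity unpacks.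
  tuple : (ρ : Fin n → Dom) → EX λ t → ∀ M → Trans M → t ∈ₛ M → ∀ i → ρ i ∈ₛ M
  tuple {zero} ρ = do
    (t , _) ← Is-ex {e = ∅ᵉ} ∅
    ex t λ _ _ _ ()
  tuple {suc n} ρ = do
    (t , all) ← tuple (ρ ∘ suc)
    (p , pp) ← upair-ex (ρ zero) t
    ex p λ M tM p∈M → λ
      { zero    → proj₁ (transitive-upair tM pp p∈M)
      ; (suc i) → all M tM (proj₂ (transitive-upair tM pp p∈M)) i }

  -- Powerset and Σ₁-Collection

  powerset : ⊨ Powerset
  powerset x n = locate x λ M (x∈M , mM , extend) →
    model-⊨ mM Powerset (powerset-ax M) x x∈M λ p p∈M χ →
    n p (let tM = model-trans mM in λ y →
      -- `χ` only yields inclusion relative to `M`; transitivity puts every element of `y` into `M`.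
      (λ y∈p z z∈y → let y∈M = tM p p∈M y y∈p in
        to (χ y y∈M) y∈p z (tM y y∈M z z∈y) z∈y)
      & λ y⊆x → ∈-stable λ n′ → extend y λ N (y∈N , mN , el) →
        -- The transferred formula, with parameters `x` and `p`, says that `p` is the power set of
        -- `x`; it is applied in `N` to the new element `y`.
        n′ (from (elementary-up mM mN el (∀' (v0 ε v1 ⇔' v0 ⊆' v2)) {∅ᵉ ▸ x ▸ p}
                   (▸∈ (▸∈ (λ ()) x∈M) p∈M) χ y y∈N)
                 (λ z _ → y⊆x z)))

  lift₂-▸ : {f : Fin m → Fin n} {ρ : Fin n → Dom} →
            ((ρ ▸ x ▸ y) ∘ lift 2 f) ≋ ((ρ ∘ f) ▸ x ▸ y)
  lift₂-▸ zero          = ≈-refl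
  lift₂-▸ (suc zero)    = ≈-refl
  lift₂-▸ (suc (suc i)) = ≈-refl

  collection : (φ : Formula (2 + n)) → Σ₁ φ → ⊨ Collection φ
  collection φ Σφ = ∀*-from
    (∀' (∀∈ v0 (∃' (ren (lift 2 (1 ↑ʳ_)) φ)) ⇒
         ∃' (∀∈ v1 (∃∈ v1 (ren (lift 2 (2 ↑ʳ_)) φ)))))
    λ ρ a total n₁ →
    tuple (ρ ▸ a) λ t in-t → locate t λ M (t∈M , mM , extend) →
    let tM = model-trans mM
        params = in-t M tM t∈M in
    -- `M` is fixed before `x` is chosen, so it can serve as the collecting set; the extension `N`
    -- may depend on `x`.
    n₁ M λ x x∈a n₂ → total x x∈a λ y φxy →
    downward {ρ = ρ ▸ x ▸ y} Σφ (ren-to φ (lift₂-▸ {f = 1 ↑ʳ_} {ρ ▸ a}) φxy) λ w down →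
    -- The pair brings both the value `y` and the witnesses for `φ` into a single extension.
    upair-ex y w λ p pp → extend p λ N (p∈N , mN , el) →
    let tN = model-trans mN
        ρx∈M = ▸∈ (params ∘ suc) (tM a (params zero) x x∈a)
        (y∈N , w∈N) = transitive-upair tN pp p∈N
        inN : Rel N (∃' φ) (ρ ▸ x)
        inN n = n y y∈N (down N tN w∈N (▸∈ (λ i → elementary-⊆ el _ (ρx∈M i)) y∈N))
    -- The value `y′` found in `M` may differ from `y`; it works in the universe because Σ₁ truth
    -- persists upward from `M`.
    in elementary-down mM mN el (∃' φ) ρx∈M inN λ y′ y′∈M q →
      n₂ y′ (y′∈M & ren-from φ (lift₂-▸ {f = 2 ↑ʳ_} {ρ ▸ a ▸ M}) (upward Σφ tM (▸∈ ρx∈M y′∈M) q))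

theorem3p10 : (LZFCˢᵉˣᵗ ⊢ Powerset) ×
    ((n : ℕ) (φ : Formula (2 + n)) → Σ₁ φ → LZFCˢᵉˣᵗ ⊢ Collection φ)
theorem3p10 =
    completeness (λ 𝓜 ⊨T → StrongExtension.powerset 𝓜 ⊨T)
  , λ n φ Σφ → completeness (λ 𝓜 ⊨T → StrongExtension.collection 𝓜 ⊨T φ Σφ)
  where open Completeness LZFCˢᵉˣᵗ
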